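{- There exists an infinite family of Boolean functions $f_n:\{0,1\}^n\times\{0,1\}^n\to\{0,1\}$ such that $$\mathbf{coNP}^{cc}(f_n)\ \ge\ \Omega\left(\mathbf{UP}^{cc}(f_n)^{1.22}\right).$$
   Context: For a two-party function $F:X\times Y\to\{0,1\}$, a (combinatorial) rectangle is a set $A\times B$ with $A\subseteq X$, $B\subseteq Y$. $\mathbf{UP}^{cc}(F)$, the unambiguous nondeterministic communication complexity, is $\log_2$ of the minimum number of pairwise disjoint rectangles whose union is $F^{ -1}(1)$. $\mathbf{coNP}^{cc}(F)$, the co-nondeterministic communication complexity, is $\log_2$ of the minimum number of (possibly overlapping) rectangles whose union is $F^{ -1}(0)$. Convention: the family is indexed by an infinite set of $n$, and $\mathbf{UP}^{cc}(f_n)\to\infty$ along it; $\Omega$ hides an absolute positive constant. -}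

module Defs where

open import Data.Bool.Base using (Bool; true; false; T)
open import Data.Fin.Base using (Fin)
open import Data.Nat.Base as ℕ using (ℕ)
open import Data.Product.Base using (_×_; ∃)
open import Data.Rational.Base as ℚ using (ℚ; ↥_; ↧ₙ_)
open import Data.Integer.Base using (∣_∣)
open import Data.Vec.Base using (Vec)
open import Level using (0ℓ)
open import Relation.Binary.PropositionalEquality using (_≢_)
open import Relation.Unary using (Pred; _∈_; _⊢_; ｛_｝; ⋃; _≐_; _⊥_; _⟨×⟩_)

import Algebra.Definitions.RawSemiring ℚ.+-*-rawSemiring as Power

private
  variable
    X Y : Set

TwoParty : Set → Set → Set
TwoParty X Y = X × Y → Bool

BooleanFunction : ℕ → Set
BooleanFunction n = TwoParty (Vec Bool n) (Vec Bool n)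

_⁻¹_ : TwoParty X Y → Bool → Pred (X × Y) 0ℓ
F ⁻¹ b = F ⊢ ｛ b ｝

-- Sides are given by characteristic functions, so membership is decidable.
record Rectangle (X Y : Set) : Set where
  field
    rows    : X → Bool
    columns : Y → Bool

⟦_⟧ : Rectangle X Y → Pred (X × Y) 0ℓ
⟦ R ⟧ = (rows ⊢ T) ⟨×⟩ (columns ⊢ T)
  where open Rectangle R

Covers : {k : ℕ} → (Fin k → Rectangle X Y) → Pred (X × Y) 0ℓ → Set
Covers {k = k} R P = ⋃ (Fin k) (λ i → ⟦ R i ⟧) ≐ P

PairwiseDisjoint : {k : ℕ} → (Fin k → Rectangle X Y) → Set
PairwiseDisjoint R = ∀ {i j} → i ≢ j → ⟦ R i ⟧ ⊥ ⟦ R j ⟧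

IsMinimum : Pred ℕ 0ℓ → Pred ℕ 0ℓ
IsMinimum P m = m ∈ P × (∀ {k} → k ∈ P → m ℕ.≤ k)

-- UP^cc(F) = log₂ u exactly when IsUPNumber F u, and coNP^cc(F) = log₂ v
-- exactly when IsCoNPNumber F v.  For finite X and Y these u and v exist
-- (cover by singletons) and are unique.
IsUPNumber : TwoParty X Y → Pred ℕ 0ℓ
IsUPNumber {X} {Y} F = IsMinimum λ k →
  ∃ λ (R : Fin k → Rectangle X Y) → PairwiseDisjoint R × Covers R (F ⁻¹ true)

IsCoNPNumber : TwoParty X Y → Pred ℕ 0ℓ
IsCoNPNumber {X} {Y} F = IsMinimum λ k →
  ∃ λ (R : Fin k → Rectangle X Y) → Covers R (F ⁻¹ false)

-- Comparison of a nonnegative rational p/q with the real number log₂ m: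
-- p/q ≤ log₂ m iff 2 ^ p ≤ m ^ q.
infix 4 _≤log₂_ _>log₂_

_≤log₂_ : ℚ → ℕ → Set
r ≤log₂ m = 2 ℕ.^ ∣ ↥ r ∣ ℕ.≤ m ℕ.^ ↧ₙ r

_>log₂_ : ℚ → ℕ → Set
s >log₂ m = m ℕ.^ ↧ₙ s ℕ.< 2 ℕ.^ ∣ ↥ s ∣

-- The real inequality c · (log₂ u)^(a/b) ≤ log₂ v for c > 0, a, b ≥ 1 and
-- u, v ≥ 1.  By density of ℚ it says c · r^(a/b) ≤ s whenever
-- 0 ≤ r ≤ log₂ u and log₂ v < s; the conclusion is raised to the power b.
-- For u = 0 or v = 0 the logarithm is in effect read as 0; that convention
-- does not matter for families along which log₂ u → ∞, since u ≥ 2 forces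
-- F to be non-constant.
LogPowerBound : (c : ℚ) (a b : ℕ) (u v : ℕ) → Set
LogPowerBound c a b u v =
  ∀ (r s : ℚ) → ℚ.NonNegative r → ℚ.NonNegative s →
  r ≤log₂ u → s >log₂ v →
  (c Power.^ b) ℚ.* (r Power.^ a) ℚ.≤ s Power.^ b

Infinite : Pred ℕ 0ℓ → Set
Infinite I = ∀ m → ∃ λ n → m ℕ.≤ n × n ∈ I

-- As UP^cc = log₂ u, the bound UP^cc ≥ k reads 2 ^ k ≤ u.
UPTendsToInfinity : Pred ℕ 0ℓ → ((n : ℕ) → BooleanFunction n) → Set
UPTendsToInfinity I f =
  ∀ (k : ℕ) → ∃ λ N → ∀ n → n ∈ I → N ℕ.≤ n →
  ∀ u → IsUPNumber (f n) u → 2 ℕ.^ k ℕ.≤ u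

{-# OPTIONS --safe #-}
module Submission where

-- Separation of queries.  On an N × N matrix of edge bits with w patch bits per
-- row (N = w²), accept iff some vertex i has no incoming edge, a set patch bit,
-- and edges to all but at most w vertices, all of whose patches are unset.  For
-- two such vertices i, j the absent edge from i to j forces the patch of j to be
-- unset, so the accepting i is unique, and it is verified with O(w²) queries.
-- Fewer than N w fixed zeros leave a row with fewer than w of them, which can
-- still become the accepting one, so the all-false input has no short certificate.
--
-- Lifting.  Compose with the index gadget on tables of size q = 2^Θ(w²).  Reading
-- the decision trees through the gadget partitions the ones into 2^O(w⁴)
-- rectangles.  Let A × B be a rectangle of zeros.  As long as some address of
-- some cell carries more than a 1/√q share of its mass on the all-false inputs,
-- fix it; after N w steps the mass is below a q^(-Nw/2) fraction.  Otherwise A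
-- contains so many rows that are pairwise different on the cells of a
-- 1-certificate that almost no column answers all of them wrongly, so B is tiny.
-- Hence 2^Ω(w⁵) rectangles are needed to cover the zeros, and 5/4 > 1.22.

open import Defs
open import Algebra.Bundles using (CommutativeMonoid)
import Algebra.Properties.CommutativeSemigroup as CommutativeSemigroupₚ
open import Data.Bool.Base using (Bool; true; false; T; _∧_; not; if_then_else_)
import Data.Bool.Properties as Boolₚ
open import Data.Fin.Base as Fin using (Fin; combine)
import Data.Fin.Properties as Finₚ
import Data.Integer.Base as ℤ
import Data.Integer.Properties as ℤₚ
open import Data.List.Base as List using (List; []; _∷_; _++_; map; concatMap; length; allFin; filter; deduplicate)
import Data.List.Membership.DecPropositional as DecMem
open import Data.List.Membership.Propositional using (_∉_; find; lose) renaming (_∈_ to _∈ₗ_)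
import Data.List.Membership.Propositional.Properties as Memₚ
import Data.List.Properties as Listₚ
open import Data.List.Relation.Unary.All as All using (All; []; _∷_)
import Data.List.Relation.Unary.All.Properties as Allₚ
open import Data.List.Relation.Unary.AllPairs as AllPairs using (AllPairs; []; _∷_)
import Data.List.Relation.Unary.AllPairs.Properties as AllPairsₚ
open import Data.List.Relation.Unary.Any as Any using (here; there)
import Data.List.Relation.Unary.Unique.DecPropositional.Properties as DecUniqueₚ
open import Data.List.Relation.Unary.Unique.Propositional using (Unique)
import Data.List.Relation.Unary.Unique.Propositional.Properties as Uniqueₚ
open import Data.Nat.Base
import Data.Nat.Coprimality as Coprimality
open import Data.Nat.Properties hiding (_≟_)
open import Data.Nat.Solver using (module +-*-Solver)
open import Data.Product.Base using (_×_; _,_; proj₁; proj₂; ∃; Σ)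
open import Data.Rational.Base as ℚ using (ℚ; Positive)
import Data.Rational.Properties as ℚₚ
import Data.Rational.Unnormalised.Base as ℚᵘ
import Data.Rational.Unnormalised.Properties as ℚᵘₚ
open import Data.Sum.Base using (inj₁; inj₂)
open import Data.Unit.Base using (⊤; tt)
open import Data.Vec.Base as Vec using (Vec; []; _∷_; lookup; _[_]≔_)
import Data.Vec.Properties as Vecₚ
open import Function.Base using (_∘_; id)
open import Function.Bundles using (Equivalence)
open import Level using (0ℓ)
open import Relation.Binary.Definitions using (DecidableEquality)
open import Relation.Binary.PropositionalEquality
open import Relation.Nullary using (¬_; Dec; yes; no; does; contradiction; ¬?)
open import Relation.Nullary.Decidable using (_→-dec_; dec-true)
open import Relation.Unary using (Pred; Decidable; _∈_)

open +-*-Solver using (solve; _:+_; _:*_; _:=_; con)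
import Algebra.Definitions.RawSemiring ℚ.+-*-rawSemiring as Power

private
  variable
    A B : Set
    n : ℕ

-- Finite sums and indicators

∑ : List A → (A → ℕ) → ℕ
∑ []       f = 0
∑ (x ∷ xs) f = f x + ∑ xs f

∑-cong : ∀ (xs : List A) {f g : A → ℕ} → (∀ x → f x ≡ g x) → ∑ xs f ≡ ∑ xs g
∑-cong []       eq = refl
∑-cong (x ∷ xs) eq = cong₂ _+_ (eq x) (∑-cong xs eq)

∑-mono : ∀ (xs : List A) {f g : A → ℕ} → (∀ x → f x ≤ g x) → ∑ xs f ≤ ∑ xs g
∑-mono []       le = z≤n
∑-mono (x ∷ xs) le = +-mono-≤ (le x) (∑-mono xs le)

∑-mono-∈ : ∀ (xs : List A) {f g : A → ℕ} → (∀ {x} → x ∈ₗ xs → f x ≤ g x) → ∑ xs f ≤ ∑ xs g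
∑-mono-∈ []       le = z≤n
∑-mono-∈ (x ∷ xs) le = +-mono-≤ (le (here refl)) (∑-mono-∈ xs (le ∘ there))

∑-const : ∀ (xs : List A) c → ∑ xs (λ _ → c) ≡ length xs * c
∑-const []       c = refl
∑-const (x ∷ xs) c = cong (c +_) (∑-const xs c)

∑-distrib-+ : ∀ (xs : List A) (f g : A → ℕ) → ∑ xs (λ x → f x + g x) ≡ ∑ xs f + ∑ xs g
∑-distrib-+ []       f g = refl
∑-distrib-+ (x ∷ xs) f g rewrite ∑-distrib-+ xs f g =
  solve 4 (λ a b c d → (a :+ b) :+ (c :+ d) := (a :+ c) :+ (b :+ d)) refl (f x) (g x) (∑ xs f) (∑ xs g)

*-distribˡ-∑ : ∀ c (xs : List A) (f : A → ℕ) → c * ∑ xs f ≡ ∑ xs (λ x → c * f x)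
*-distribˡ-∑ c []       f = *-zeroʳ c
*-distribˡ-∑ c (x ∷ xs) f = trans (*-distribˡ-+ c (f x) _) (cong (c * f x +_) (*-distribˡ-∑ c xs f))

∑-swap : ∀ (xs : List A) (ys : List B) (f : A → B → ℕ) →
         ∑ xs (λ x → ∑ ys (f x)) ≡ ∑ ys (λ y → ∑ xs (λ x → f x y))
∑-swap []       ys f = sym (trans (∑-const ys 0) (*-zeroʳ (length ys)))
∑-swap (x ∷ xs) ys f =
  trans (cong (∑ ys (f x) +_) (∑-swap xs ys f)) (sym (∑-distrib-+ ys (f x) _))

∑-++ : ∀ (xs ys : List A) (f : A → ℕ) → ∑ (xs ++ ys) f ≡ ∑ xs f + ∑ ys f
∑-++ []       ys f = refl
∑-++ (x ∷ xs) ys f = trans (cong (f x +_) (∑-++ xs ys f)) (sym (+-assoc (f x) _ _))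

∑-map : ∀ (h : A → B) (xs : List A) (f : B → ℕ) → ∑ (map h xs) f ≡ ∑ xs (f ∘ h)
∑-map h []       f = refl
∑-map h (x ∷ xs) f = cong (f (h x) +_) (∑-map h xs f)

∑-concatMap : ∀ (h : A → List B) (xs : List A) (f : B → ℕ) →
              ∑ (concatMap h xs) f ≡ ∑ xs (λ x → ∑ (h x) f)
∑-concatMap h []       f = refl
∑-concatMap h (x ∷ xs) f = trans (∑-++ (h x) _ f) (cong (∑ (h x) f +_) (∑-concatMap h xs f))

length-as-∑ : ∀ (xs : List A) → ∑ xs (λ _ → 1) ≡ length xs
length-as-∑ xs = trans (∑-const xs 1) (*-identityʳ _)

f≤∑ : ∀ {xs : List A} (f : A → ℕ) {x} → x ∈ₗ xs → f x ≤ ∑ xs f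
f≤∑ {xs = y ∷ ys} f (here refl) = m≤m+n (f y) (∑ ys f)
f≤∑ {xs = y ∷ ys} f (there x∈)  = ≤-trans (f≤∑ f x∈) (m≤n+m (∑ ys f) (f y))

∑-<⇒∃ : ∀ (xs : List A) {f g : A → ℕ} → ∑ xs f < ∑ xs g → ∃ λ x → x ∈ₗ xs × f x < g x
∑-<⇒∃ (x ∷ xs) {f} {g} lt with f x <? g x
... | yes fx<gx = x , here refl , fx<gx
... | no  fx≮gx with ∑-<⇒∃ xs (+-cancelˡ-< (g x) _ _ (≤-<-trans (+-monoˡ-≤ (∑ xs f) (≮⇒≥ fx≮gx)) lt))
...   | y , y∈ , fy<gy = y , there y∈ , fy<gy

∑-allFin : ∀ n (f : Fin (suc n) → ℕ) →
           ∑ (allFin (suc n)) f ≡ f Fin.zero + ∑ (allFin n) (f ∘ Fin.suc)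
∑-allFin n f = cong (f Fin.zero +_)
  (trans (cong (λ xs → ∑ xs f) (sym (Listₚ.map-tabulate id Fin.suc))) (∑-map Fin.suc (allFin n) f))

𝟙 : Bool → ℕ
𝟙 true  = 1
𝟙 false = 0

𝟙≤1 : ∀ b → 𝟙 b ≤ 1
𝟙≤1 true  = ≤-refl
𝟙≤1 false = z≤n

𝟙-∧ : ∀ a b → 𝟙 (a ∧ b) ≡ 𝟙 a * 𝟙 b
𝟙-∧ true  b = sym (+-identityʳ (𝟙 b))
𝟙-∧ false b = refl

module _ {P : Set} where

  𝟙-yes : (P? : Dec P) → P → 𝟙 (does P?) ≡ 1
  𝟙-yes (yes _) p = refl
  𝟙-yes (no ¬p) p = contradiction p ¬p

  𝟙-no : (P? : Dec P) → ¬ P → 𝟙 (does P?) ≡ 0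
  𝟙-no (yes p) ¬p = contradiction p ¬p
  𝟙-no (no _)  ¬p = refl

-- `∑-point` expresses, in the form in which sums use it, that `letters` lists every element exactly
-- once.
record Alphabet (A : Set) : Set where
  infix 4 _≟_
  field
    _≟_     : DecidableEquality A
    letters : List A
    ∑-point : ∀ a (f : A → ℕ) → ∑ letters (λ b → 𝟙 (does (b ≟ a)) * f b) ≡ f a

  size : ℕ
  size = length letters

finAlphabet : ∀ n → Alphabet (Fin n)
finAlphabet n = record { _≟_ = Finₚ._≟_ ; letters = allFin n ; ∑-point = point n }
  where
  point : ∀ n a (f : Fin n → ℕ) → ∑ (allFin n) (λ b → 𝟙 (does (b Finₚ.≟ a)) * f b) ≡ f a
  point (suc n) Fin.zero f = trans (∑-allFin n _)
    (trans (cong₂ _+_ (*-identityˡ (f Fin.zero)) (trans (∑-const (allFin n) 0) (*-zeroʳ (length (allFin n)))))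
           (+-identityʳ _))
  point (suc n) (Fin.suc a) f = trans (∑-allFin n (λ b → 𝟙 (does (b Finₚ.≟ Fin.suc a)) * f b)) (point n a (f ∘ Fin.suc))

boolAlphabet : Alphabet Bool
boolAlphabet = record
  { _≟_     = Boolₚ._≟_
  ; letters = true ∷ false ∷ []
  ; ∑-point = λ { true  f → trans (+-identityʳ _) (*-identityˡ _)
                ; false f → trans (+-identityʳ _) (*-identityˡ _) }
  }

-- Counting words

module Words {A : Set} (𝔸 : Alphabet A) where

  open Alphabet 𝔸

  words : ∀ n → List (Vec A n)
  words zero    = [] ∷ []
  words (suc n) = concatMap (λ a → map (a ∷_) (words n)) letters

  ∑-words-suc : ∀ n (f : Vec A (suc n) → ℕ) →
                ∑ (words (suc n)) f ≡ ∑ letters (λ a → ∑ (words n) (λ w → f (a ∷ w)))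
  ∑-words-suc n f = trans (∑-concatMap _ letters f) (∑-cong letters λ a → ∑-map (a ∷_) (words n) f)

  length-words : ∀ n → length (words n) ≡ size ^ n
  length-words n = trans (sym (length-as-∑ (words n))) (go n)
    where
    go : ∀ n → ∑ (words n) (λ _ → 1) ≡ size ^ n
    go zero    = refl
    go (suc n) = trans (∑-words-suc n _) (trans (∑-cong letters (λ _ → go n)) (∑-const letters _))

  Invariant : Fin n → (Vec A n → ℕ) → Set
  Invariant v φ = ∀ w a → φ (w [ v ]≔ a) ≡ φ w

  -- Slicing the sum by the letter at `v` gives `size` slices, all equal because `φ` ignores that
  -- letter; the indicator keeps one of them.
  ∑-fix-letter : ∀ (v : Fin n) a (φ : Vec A n → ℕ) → Invariant v φ →
                 size * ∑ (words n) (λ w → 𝟙 (does (lookup w v ≟ a)) * φ w) ≡ ∑ (words n) φ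
  ∑-fix-letter {suc n} Fin.zero a φ inv = begin
    size * ∑ (words (suc n)) (λ w → 𝟙 (does (lookup w Fin.zero ≟ a)) * φ w)
      ≡⟨ cong (size *_) (∑-words-suc n _) ⟩
    size * ∑ letters (λ b → ∑ (words n) (λ w → 𝟙 (does (b ≟ a)) * φ (b ∷ w)))
      ≡⟨ cong (size *_) (∑-cong letters λ b → sym (*-distribˡ-∑ (𝟙 (does (b ≟ a))) (words n) _)) ⟩
    size * ∑ letters (λ b → 𝟙 (does (b ≟ a)) * ∑ (words n) (λ w → φ (b ∷ w)))
      ≡⟨ cong (size *_) (∑-point a _) ⟩
    size * ∑ (words n) (λ w → φ (a ∷ w))
      ≡⟨ ∑-const letters _ ⟨
    ∑ letters (λ b → ∑ (words n) (λ w → φ (a ∷ w)))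
      ≡⟨ ∑-cong letters (λ b → ∑-cong (words n) λ w → inv (b ∷ w) a) ⟩
    ∑ letters (λ b → ∑ (words n) (λ w → φ (b ∷ w)))
      ≡⟨ ∑-words-suc n φ ⟨
    ∑ (words (suc n)) φ ∎
    where open ≡-Reasoning
  ∑-fix-letter {suc n} (Fin.suc v) a φ inv = begin
    size * ∑ (words (suc n)) (λ w → 𝟙 (does (lookup w (Fin.suc v) ≟ a)) * φ w)
      ≡⟨ cong (size *_) (∑-words-suc n _) ⟩
    size * ∑ letters (λ b → ∑ (words n) (λ w → 𝟙 (does (lookup w v ≟ a)) * φ (b ∷ w)))
      ≡⟨ *-distribˡ-∑ size letters _ ⟩
    ∑ letters (λ b → size * ∑ (words n) (λ w → 𝟙 (does (lookup w v ≟ a)) * φ (b ∷ w)))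
      ≡⟨ ∑-cong letters (λ b → ∑-fix-letter v a (φ ∘ (b ∷_)) (λ w → inv (b ∷ w))) ⟩
    ∑ letters (λ b → ∑ (words n) (λ w → φ (b ∷ w)))
      ≡⟨ ∑-words-suc n φ ⟨
    ∑ (words (suc n)) φ ∎
    where open ≡-Reasoning

  matches : List (Fin n × A) → Vec A n → ℕ
  matches []             w = 1
  matches ((v , a) ∷ ps) w = 𝟙 (does (lookup w v ≟ a)) * matches ps w

  matches≤1 : ∀ (ps : List (Fin n × A)) w → matches ps w ≤ 1
  matches≤1 []             w = ≤-refl
  matches≤1 ((v , a) ∷ ps) w = *-mono-≤ (𝟙≤1 (does (lookup w v ≟ a))) (matches≤1 ps w)

  matches-all : ∀ {ps : List (Fin n × A)} {w} → All (λ p → lookup w (proj₁ p) ≡ proj₂ p) ps → matches ps w ≡ 1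
  matches-all {w = w} []                              = refl
  matches-all {w = w} (_∷_ {x = v , a} eq eqs) = cong₂ _*_ (𝟙-yes (lookup w v ≟ a) eq) (matches-all eqs)

  all-matches : ∀ (ps : List (Fin n × A)) {w} → matches ps w ≢ 0 → All (λ p → lookup w (proj₁ p) ≡ proj₂ p) ps
  all-matches []             ≢0 = []
  all-matches ((v , a) ∷ ps) {w} ≢0 with lookup w v ≟ a
  ... | yes eq = eq ∷ all-matches ps (≢0 ∘ trans (+-identityʳ _))
  ... | no  _  = contradiction refl ≢0

  matches-invariant : ∀ {v : Fin n} {ps : List (Fin n × A)} → All (λ p → v ≢ proj₁ p) ps → Invariant v (matches ps)
  matches-invariant {ps = []}           []             w b = refl
  matches-invariant {ps = (u , a) ∷ ps} (v≢u ∷ v∉) w b =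
    cong₂ (λ c m → 𝟙 (does (c ≟ a)) * m) (Vecₚ.lookup∘update′ (v≢u ∘ sym) w b) (matches-invariant v∉ w b)

  -- For a uniformly random word, matching `ps` is independent of `φ` and has probability one in
  -- `size ^ length ps`. The indicator of the head joins the weight while the tail is fixed, which
  -- keeps the weight invariant because positions are distinct.
  ∑-fix-letters : ∀ (ps : List (Fin n × A)) → Unique (map proj₁ ps) → (φ : Vec A n → ℕ) →
                  All (λ p → Invariant (proj₁ p) φ) ps →
                  size ^ length ps * ∑ (words n) (λ w → matches ps w * φ w) ≡ ∑ (words n) φ
  ∑-fix-letters {n} [] uniq φ inv =
    trans (*-identityˡ _) (∑-cong (words n) λ w → *-identityˡ (φ w))
  ∑-fix-letters {n} ((v , a) ∷ ps) (v∉ ∷ uniq) φ (iv ∷ inv) = begin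
    size * size ^ length ps * ∑ (words n) (λ w → 𝟙 (does (lookup w v ≟ a)) * matches ps w * φ w)
      ≡⟨ *-assoc size _ _ ⟩
    size * (size ^ length ps * ∑ (words n) (λ w → 𝟙 (does (lookup w v ≟ a)) * matches ps w * φ w))
      ≡⟨ cong (λ x → size * (size ^ length ps * x)) (∑-cong (words n) λ w →
           solve 3 (λ x y z → x :* y :* z := y :* (x :* z)) refl (𝟙 (does (lookup w v ≟ a))) (matches ps w) (φ w)) ⟩
    size * (size ^ length ps * ∑ (words n) (λ w → matches ps w * (𝟙 (does (lookup w v ≟ a)) * φ w)))
      ≡⟨ cong (size *_) (∑-fix-letters ps uniq _ (inv′ ps v∉ inv)) ⟩
    size * ∑ (words n) (λ w → 𝟙 (does (lookup w v ≟ a)) * φ w)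
      ≡⟨ ∑-fix-letter v a φ iv ⟩
    ∑ (words n) φ ∎
    where
    open ≡-Reasoning
    inv′ : ∀ ps → All (v ≢_) (map proj₁ ps) → All (λ p → Invariant (proj₁ p) φ) ps →
           All (λ p → Invariant (proj₁ p) (λ w → 𝟙 (does (lookup w v ≟ a)) * φ w)) ps
    inv′ []       []         []         = []
    inv′ (p ∷ ps) (v≢p ∷ v≢) (ip ∷ ips) =
      (λ w b → cong₂ (λ c m → 𝟙 (does (c ≟ a)) * m) (Vecₚ.lookup∘update′ v≢p w b) (ip w b)) ∷ inv′ ps v≢ ips

-- Positivity of indicators, and inequalities between powers

𝟙>0⇒T : ∀ {b} → 0 < 𝟙 b → T b
𝟙>0⇒T {true} _ = tt

T⇒𝟙≡1 : ∀ {b} → T b → 𝟙 b ≡ 1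
T⇒𝟙≡1 {true} _ = refl

m*n>0⇒m>0 : ∀ m {n} → 0 < m * n → 0 < m
m*n>0⇒m>0 (suc m) _ = z<s

m*n>0⇒n>0 : ∀ m {n} → 0 < m * n → 0 < n
m*n>0⇒n>0 m {n} gt = m*n>0⇒m>0 n (subst (0 <_) (*-comm m n) gt)

[m*n]*o≡[m*o]*n : ∀ m n o → m * n * o ≡ m * o * n
[m*n]*o≡[m*o]*n = solve 3 (λ m n o → m :* n :* o := m :* o :* n) refl

-- Bernoulli's inequality `1 + r / m ≤ (1 + 1 / m) ^ r`, cleared of denominators.
bernoulli : ∀ m r → (m + r) * m ^ r ≤ m * suc m ^ r
bernoulli m zero    = ≤-reflexive (cong (_* 1) (+-identityʳ m))
bernoulli m (suc r) = begin
  (m + suc r) * (m * m ^ r)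
    ≤⟨ m≤m+n _ (r * m ^ r) ⟩
  (m + suc r) * (m * m ^ r) + r * m ^ r
    ≡⟨ solve 3 (λ m r p → (m :+ (con 1 :+ r)) :* (m :* p) :+ r :* p := (con 1 :+ m) :* ((m :+ r) :* p)) refl m r (m ^ r) ⟩
  suc m * ((m + r) * m ^ r)
    ≤⟨ *-monoʳ-≤ (suc m) (bernoulli m r) ⟩
  suc m * (m * suc m ^ r)
    ≡⟨ solve 3 (λ s m p → s :* (m :* p) := m :* (s :* p)) refl (suc m) m (suc m ^ r) ⟩
  m * (suc m * suc m ^ r) ∎
  where open ≤-Reasoning

-- That is, `(1 - 1 / (1 + m)) ^ (1 + m) ≤ 1 / 2`, from Bernoulli with `r = 1 + m`. A factor `m` is
-- cancelled, so `m = 0` is treated apart; it occurs for empty patterns, where `size ^ 0 = 1`.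
2*m^[1+m]≤[1+m]^[1+m] : ∀ m → 2 * m ^ suc m ≤ suc m ^ suc m
2*m^[1+m]≤[1+m]^[1+m] zero      = z≤n
2*m^[1+m]≤[1+m]^[1+m] m@(suc _) = *-cancelˡ-≤ m (begin
  m * (2 * m ^ suc m)       ≡⟨ solve 2 (λ m p → m :* (con 2 :* p) := (m :+ m) :* p) refl m (m ^ suc m) ⟩
  (m + m) * m ^ suc m       ≤⟨ *-monoˡ-≤ (m ^ suc m) (+-monoʳ-≤ m (n≤1+n m)) ⟩
  (m + suc m) * m ^ suc m   ≤⟨ bernoulli m (suc m) ⟩
  m * suc m ^ suc m         ∎)
  where open ≤-Reasoning

^-distribʳ-* : ∀ m n o → (m * n) ^ o ≡ m ^ o * n ^ o
^-distribʳ-* m n zero    = refl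
^-distribʳ-* m n (suc o) rewrite ^-distribʳ-* m n o =
  solve 4 (λ m n p r → m :* n :* (p :* r) := m :* p :* (n :* r)) refl m n (m ^ o) (n ^ o)

2^D*m^≤[1+m]^ : ∀ m D → 2 ^ D * m ^ (suc m * D) ≤ suc m ^ (suc m * D)
2^D*m^≤[1+m]^ m D = begin
  2 ^ D * m ^ (suc m * D)   ≡⟨ cong (2 ^ D *_) (^-*-assoc m (suc m) D) ⟨
  2 ^ D * (m ^ suc m) ^ D   ≡⟨ ^-distribʳ-* 2 (m ^ suc m) D ⟨
  (2 * m ^ suc m) ^ D       ≤⟨ ^-monoˡ-≤ D (2*m^[1+m]≤[1+m]^[1+m] m) ⟩
  (suc m ^ suc m) ^ D       ≡⟨ ^-*-assoc (suc m) (suc m) D ⟩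
  suc m ^ (suc m * D)       ∎
  where open ≤-Reasoning

-- Words avoiding patterns on disjoint positions

module Avoidance {A : Set} (𝔸 : Alphabet A) where

  open Alphabet 𝔸 using (size)
  open Words 𝔸

  Pattern : ℕ → Set
  Pattern n = List (Fin n × A)

  -- An indicator: truncated subtraction is harmless since `matches` is at most `1`.
  avoids : List (Pattern n) → Vec A n → ℕ
  avoids []       w = 1
  avoids (P ∷ Ps) w = (1 ∸ matches P w) * avoids Ps w

  avoids≡0⇒match : ∀ (Ps : List (Pattern n)) {w} → avoids Ps w ≡ 0 → ∃ λ P → P ∈ₗ Ps × matches P w ≢ 0
  avoids≡0⇒match (P ∷ Ps) {w} eq with matches P w in eqP
  ... | suc _ = P , here refl , λ eq′ → contradiction (trans (sym eqP) eq′) λ ()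
  ... | zero  with avoids≡0⇒match Ps (trans (sym (+-identityʳ _)) eq)
  ...   | Q , Q∈ , m≢0 = Q , there Q∈ , m≢0

  Apart : Pattern n → Pattern n → Set
  Apart P Q = All (λ p → All (λ q → proj₁ p ≢ proj₁ q) Q) P

  avoids-invariant : ∀ {v : Fin n} {Ps} → All (All (λ p → v ≢ proj₁ p)) Ps → Invariant v (avoids Ps)
  avoids-invariant []        w a = refl
  avoids-invariant (v≢ ∷ v≢s) w a =
    cong₂ (λ m c → (1 ∸ m) * c) (matches-invariant v≢ w a) (avoids-invariant v≢s w a)

  module _ {n : ℕ} (m r : ℕ) (size^r : size ^ r ≡ suc m) where

    -- A pattern with `r` distinct positions is matched with probability `1 / (1 + m)`. Patterns on
    -- disjoint positions are matched independently, so each multiplies the share of avoiding words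
    -- by `m / (1 + m)`.
    ∑-avoids-bound : ∀ (Ps : List (Pattern n)) → All (λ P → length P ≡ r) Ps →
                     All (λ P → Unique (map proj₁ P)) Ps → AllPairs Apart Ps →
                     suc m ^ length Ps * ∑ (words n) (avoids Ps) ≤ m ^ length Ps * size ^ n
    ∑-avoids-bound [] _ _ _ = *-monoʳ-≤ 1 (≤-reflexive (trans (length-as-∑ (words n)) (length-words n)))
    ∑-avoids-bound (P ∷ Ps) (len ∷ lens) (uniq ∷ uniqs) (apart ∷ aparts) = begin
      suc m * suc m ^ length Ps * s′     ≡⟨ [m*n]*o≡[m*o]*n (suc m) (suc m ^ length Ps) s′ ⟩
      suc m * s′ * suc m ^ length Ps     ≡⟨ cong (_* suc m ^ length Ps) step ⟩
      m * s * suc m ^ length Ps          ≡⟨ solve 3 (λ m s p → m :* s :* p := m :* (p :* s)) refl m s (suc m ^ length Ps) ⟩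
      m * (suc m ^ length Ps * s)        ≤⟨ *-monoʳ-≤ m (∑-avoids-bound Ps lens uniqs aparts) ⟩
      m * (m ^ length Ps * size ^ n)     ≡⟨ *-assoc m _ _ ⟨
      m * m ^ length Ps * size ^ n       ∎
      where
      open ≤-Reasoning
      s s′ h : ℕ
      s  = ∑ (words n) (avoids Ps)
      s′ = ∑ (words n) (avoids (P ∷ Ps))
      h  = ∑ (words n) (λ w → matches P w * avoids Ps w)

      flip : ∀ {p} {Qs : List (Pattern n)} → All (Apart P) Qs → p ∈ₗ P → All (All (λ q → proj₁ p ≢ proj₁ q)) Qs
      flip []       p∈ = []
      flip (a ∷ as) p∈ = All.lookup a p∈ ∷ flip as p∈

      hits : suc m * h ≡ s
      hits = trans (cong (_* h) (trans (sym size^r) (cong (size ^_) (sym len))))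
        (∑-fix-letters P uniq (avoids Ps) (All.tabulate λ p∈ → avoids-invariant (flip apart p∈)))

      split : s ≡ s′ + h
      split = trans (∑-cong (words n) λ w → pointwise (matches P w) (avoids Ps w) (matches≤1 P w))
                    (∑-distrib-+ (words n) _ _)
        where
        pointwise : ∀ i j → i ≤ 1 → j ≡ (1 ∸ i) * j + i * j
        pointwise zero          j _ = sym (trans (+-identityʳ _) (+-identityʳ _))
        pointwise (suc zero)    j _ = sym (+-identityʳ j)
        pointwise (suc (suc _)) j (s≤s ())

      -- Subtraction-free form of `s′ = s - h`, with `h` a `1 / (1 + m)` share of `s`: after adding
      -- `suc m * h` to both sides only sums occur.
      step : suc m * s′ ≡ m * s
      step = +-cancelʳ-≡ (suc m * h) (suc m * s′) (m * s) (begin-equality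
        suc m * s′ + suc m * h   ≡⟨ *-distribˡ-+ (suc m) s′ h ⟨
        suc m * (s′ + h)         ≡⟨ cong (suc m *_) split ⟨
        s + m * s                ≡⟨ +-comm s _ ⟩
        m * s + s                ≡⟨ cong (m * s +_) hits ⟨
        m * s + suc m * h        ∎)

    -- Each block of `suc m` patterns at least halves the share of avoiding words, so `D` blocks
    -- leave at most one word in `2 ^ D`.
    few-avoid : ∀ D (Ps : List (Pattern n)) → length Ps ≡ suc m * D → All (λ P → length P ≡ r) Ps →
                All (λ P → Unique (map proj₁ P)) Ps → AllPairs Apart Ps →
                2 ^ D * ∑ (words n) (avoids Ps) ≤ size ^ n
    few-avoid D Ps refl′ lens uniqs aparts = *-cancelˡ-≤ L {{m^n≢0 (suc m) (length Ps)}} (begin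
      L * (2 ^ D * s)              ≡⟨ solve 3 (λ x y z → x :* (y :* z) := y :* (x :* z)) refl L (2 ^ D) s ⟩
      2 ^ D * (L * s)              ≤⟨ *-monoʳ-≤ (2 ^ D) (∑-avoids-bound Ps lens uniqs aparts) ⟩
      2 ^ D * (m ^ length Ps * size ^ n) ≡⟨ *-assoc (2 ^ D) _ _ ⟨
      2 ^ D * m ^ length Ps * size ^ n   ≤⟨ *-monoˡ-≤ (size ^ n) (subst (λ l → 2 ^ D * m ^ l ≤ suc m ^ l) (sym refl′) (2^D*m^≤[1+m]^ m D)) ⟩
      L * size ^ n                 ∎)
      where
      open ≤-Reasoning
      L s : ℕ
      L = suc m ^ length Ps
      s = ∑ (words n) (avoids Ps)

-- Choosing pairwise different words under a spread weight

module Spread {A : Set} (𝔸 : Alphabet A) where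

  open Alphabet 𝔸
  open Words 𝔸

  DifferOn : List (Fin n) → Vec A n → Vec A n → Set
  DifferOn C w w′ = ∀ v → v ∈ₗ C → lookup w v ≢ lookup w′ v

  module _ (W : Vec A n → ℕ) (C : List (Fin n)) (τ : ℕ)
           (spread : ∀ {v} → v ∈ₗ C → ∀ a → τ * ∑ (words n) (λ w → 𝟙 (does (lookup w v ≟ a)) * W w) ≤ ∑ (words n) W)
           (W>0 : 0 < ∑ (words n) W) where

    -- Greedy choice. For each chosen word and each `v` in `C`, the words agreeing with it at `v`
    -- carry at most a `1 / τ` share of the weight. Hence `j` chosen words rule out at most
    -- `j * length C / τ < 1` of it, and another word remains.
    pick : ∀ j → j * length C < τ →
           ∃ λ ws → length ws ≡ j × All (λ w → 0 < W w) ws × AllPairs (DifferOn C) ws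
    pick zero    lt = [] , refl , [] , []
    pick (suc j) lt with pick j (≤-<-trans (m≤n+m _ (length C)) lt)
    ... | ws , len , pos , differ =
      let w , _ , cw<Ww = ∑-<⇒∃ (words n) clash<W
      in w ∷ ws , cong suc len , ≤-<-trans z≤n cw<Ww ∷ pos , All.tabulate (λ w′∈ → differs cw<Ww w′∈) ∷ differ
      where
      total : ℕ
      total = ∑ (words n) W

      agree : Vec A n → Vec A n → Fin n → ℕ
      agree w w′ v = 𝟙 (does (lookup w v ≟ lookup w′ v)) * W w

      -- Here `W w` is counted once per agreement with a chosen word, so `clash w < W w` forces both
      -- positive weight and no agreement at all.
      clash : Vec A n → ℕ
      clash w = ∑ ws λ w′ → ∑ C (agree w w′)

      clash-bound : τ * ∑ (words n) clash ≤ j * length C * total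
      clash-bound = begin
        τ * ∑ (words n) clash
          ≡⟨ cong (τ *_) (trans (∑-swap (words n) ws _) (∑-cong ws λ w′ → ∑-swap (words n) C _)) ⟩
        τ * ∑ ws (λ w′ → ∑ C λ v → ∑ (words n) λ w → agree w w′ v)
          ≡⟨ trans (*-distribˡ-∑ τ ws _) (∑-cong ws λ w′ → *-distribˡ-∑ τ C _) ⟩
        ∑ ws (λ w′ → ∑ C λ v → τ * ∑ (words n) λ w → agree w w′ v)
          ≤⟨ ∑-mono ws (λ w′ → ∑-mono-∈ C λ {v} v∈ → spread v∈ (lookup w′ v)) ⟩
        ∑ ws (λ w′ → ∑ C λ v → total)
          ≡⟨ trans (∑-cong ws λ w′ → ∑-const C total) (∑-const ws _) ⟩
        length ws * (length C * total)
          ≡⟨ trans (cong (_* (length C * total)) len) (sym (*-assoc j (length C) total)) ⟩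
        j * length C * total ∎
        where open ≤-Reasoning

      clash<W : ∑ (words n) clash < total
      clash<W = *-cancelˡ-< τ _ _ (≤-<-trans clash-bound
        (*-monoˡ-< total {{>-nonZero W>0}} (≤-<-trans (m≤n+m _ (length C)) lt)))

      differs : ∀ {w} → clash w < W w → ∀ {w′} → w′ ∈ₗ ws → DifferOn C w w′
      differs {w} lt {w′} w′∈ v v∈ eq = <⇒≱ lt (begin
        W w                    ≡⟨ *-identityˡ (W w) ⟨
        1 * W w                ≡⟨ cong (_* W w) (𝟙-yes (lookup w v ≟ lookup w′ v) eq) ⟨
        agree w w′ v           ≤⟨ f≤∑ (agree w w′) v∈ ⟩
        ∑ C (agree w w′)       ≤⟨ f≤∑ (λ w′ → ∑ C (agree w w′)) w′∈ ⟩
        clash w                ∎)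
        where open ≤-Reasoning

T-∧ˡ : ∀ {a b} → T (a ∧ b) → T a
T-∧ˡ {true} _ = tt

T-∧ʳ : ∀ {a b} → T (a ∧ b) → T b
T-∧ʳ {true} t = t

T-does : ∀ {P : Set} (P? : Dec P) → T (does P?) → P
T-does (yes p) _ = p

-- The index gadget: cell v holds the entry of Bob's v-th table at Alice's v-th address.

module Index (n q : ℕ) where

  X Y : Set
  X = Vec (Fin q) n
  Y = Vec Bool (n * q)

  cell : X → Fin n → Fin (n * q)
  cell x v = combine v (lookup x v)

  answers : X → Y → Fin n → Bool
  answers x y v = lookup y (cell x v)

-- Lower bound for covering the zeros of a lifted function

module Lifting (n q : ℕ) (f : (Fin n → Bool) → Bool) where

  open Index n q

  open Alphabet (finAlphabet q) using () renaming (_≟_ to _≟ᵃ_; size to size-q)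
  module 𝕏 = Words (finAlphabet q)
  module 𝕐 = Words boolAlphabet
  open Avoidance boolAlphabet
  open Spread (finAlphabet q)

  lifted : TwoParty X Y
  lifted (x , y) = f (answers x y)

  -- The bits Bob's tables must hold for row `x` to receive the answers `z` on `C`. This turns wrong
  -- answers into pattern avoidance.
  demand : List (Fin n) → (Fin n → Bool) → X → Pattern (n * q)
  demand C z x = map (λ v → cell x v , z v) C

  pattern-unique : ∀ {C} z x → Unique C → Unique (map proj₁ (demand C z x))
  pattern-unique {C} z x uniq = subst Unique (Listₚ.map-∘ C)
    (Uniqueₚ.map⁺ (λ {u} {v} → Finₚ.combine-injectiveˡ u (lookup x u) v (lookup x v)) uniq)

  -- Cells with different indices lie in different tables; cells with the same index are separated
  -- by the differing addresses.
  pattern-apart : ∀ C z {x x′} → DifferOn C x x′ → Apart (demand C z x) (demand C z x′)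
  pattern-apart C z {x} {x′} differ = Allₚ.map⁺ (All.tabulate λ {u} u∈ → Allₚ.map⁺ (All.tabulate λ {v} v∈ eq →
    differ u u∈ (trans (Finₚ.combine-injectiveʳ u (lookup x u) v (lookup x′ v) eq)
      (cong (lookup x′) (sym (Finₚ.combine-injectiveˡ u (lookup x u) v (lookup x′ v) eq))))))

  matches⇒answers : ∀ C z {x y} → 𝕐.matches (demand C z x) y ≢ 0 → ∀ {v} → v ∈ₗ C → answers x y v ≡ z v
  matches⇒answers C z {x} m≢0 = All.lookup (Allₚ.map⁻ (𝕐.all-matches (demand C z x) m≢0))

  zeros : X → Pattern (n * q)
  zeros = demand (allFin n) (λ _ → false)

  zeros⇒answers : ∀ x {y} → 0 < 𝕐.matches (zeros x) y → ∀ v → answers x y v ≡ false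
  zeros⇒answers x gt v = matches⇒answers (allFin n) _ {x} (m<n⇒n≢0 gt) (Memₚ.∈-allFin v)

  size-q≡q : size-q ≡ q
  size-q≡q = Listₚ.length-tabulate id

  count-zeros : ∀ x → 2 ^ n * ∑ (𝕐.words (n * q)) (𝕐.matches (zeros x)) ≡ 2 ^ (n * q)
  count-zeros x = begin
    2 ^ n * ∑ (𝕐.words (n * q)) (𝕐.matches (zeros x))
      ≡⟨ cong₂ (λ l s → 2 ^ l * s)
           (sym (trans (Listₚ.length-map (λ v → cell x v , false) (allFin n)) (Listₚ.length-tabulate {n = n} id)))
           (∑-cong (𝕐.words (n * q)) λ y → sym (*-identityʳ (𝕐.matches (zeros x) y))) ⟩
    2 ^ length (zeros x) * ∑ (𝕐.words (n * q)) (λ y → 𝕐.matches (zeros x) y * 1)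
      ≡⟨ 𝕐.∑-fix-letters (zeros x) (pattern-unique _ x (Uniqueₚ.allFin⁺ n)) (λ _ → 1) (All.tabulate λ _ _ _ → refl) ⟩
    ∑ (𝕐.words (n * q)) (λ _ → 1)
      ≡⟨ trans (length-as-∑ (𝕐.words (n * q))) (𝕐.length-words (n * q)) ⟩
    2 ^ (n * q) ∎
    where open ≡-Reasoning

  count-agreeing : ∀ {I} → Unique I → (α : X) →
    q ^ length I * ∑ (𝕏.words n) (𝕏.matches (map (λ v → v , lookup α v) I)) ≡ q ^ n
  count-agreeing {I} uniq α = begin
    q ^ length I * ∑ (𝕏.words n) (𝕏.matches P)
      ≡⟨ cong₂ (λ l s → l * s) (cong₂ _^_ (sym size-q≡q) (sym (Listₚ.length-map _ I)))
           (∑-cong (𝕏.words n) λ x → sym (*-identityʳ _)) ⟩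
    size-q ^ length P * ∑ (𝕏.words n) (λ x → 𝕏.matches P x * 1)
      ≡⟨ 𝕏.∑-fix-letters P (subst Unique (trans (sym (Listₚ.map-id I)) (Listₚ.map-∘ I)) uniq)
           (λ _ → 1) (All.tabulate λ _ _ _ → refl) ⟩
    ∑ (𝕏.words n) (λ _ → 1)
      ≡⟨ trans (length-as-∑ (𝕏.words n)) (trans (𝕏.length-words n) (cong (_^ n) size-q≡q)) ⟩
    q ^ n ∎
    where
    open ≡-Reasoning
    P : List (Fin n × Fin q)
    P = map (λ v → v , lookup α v) I

  -- The hard distribution, unnormalised: `mass` counts the pairs of `A × B` whose gadget answers
  -- are all false.
  weight : (X → Bool) → (Y → Bool) → X → Y → ℕ
  weight A B x y = 𝟙 (A x) * (𝟙 (B y) * 𝕐.matches (zeros x) y)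

  rowWeight : (X → Bool) → (Y → Bool) → X → ℕ
  rowWeight A B x = ∑ (𝕐.words (n * q)) (weight A B x)

  mass : (X → Bool) → (Y → Bool) → ℕ
  mass A B = ∑ (𝕏.words n) (rowWeight A B)

  weight≤1 : ∀ A B x y → weight A B x y ≤ 1
  weight≤1 A B x y = *-mono-≤ (𝟙≤1 (A x)) (*-mono-≤ (𝟙≤1 (B y)) (𝕐.matches≤1 (zeros x) y))

  weight≤matches : ∀ A B x y → weight A B x y ≤ 𝟙 (A x) * 𝕐.matches (zeros x) y
  weight≤matches A B x y = *-monoʳ-≤ (𝟙 (A x))
    (subst (𝟙 (B y) * 𝕐.matches (zeros x) y ≤_) (*-identityˡ _) (*-monoˡ-≤ (𝕐.matches (zeros x) y) (𝟙≤1 (B y))))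

  restrict : Fin n → Fin q → (X → Bool) → X → Bool
  restrict v a A x = does (lookup x v ≟ᵃ a) ∧ A x

  rowWeight-restrict : ∀ v a A B x →
    rowWeight (restrict v a A) B x ≡ 𝟙 (does (lookup x v ≟ᵃ a)) * rowWeight A B x
  rowWeight-restrict v a A B x = trans (∑-cong (𝕐.words (n * q)) λ y →
      trans (cong (_* _) (𝟙-∧ (does (lookup x v ≟ᵃ a)) (A x))) (*-assoc (𝟙 (does (lookup x v ≟ᵃ a))) _ _))
    (sym (*-distribˡ-∑ (𝟙 (does (lookup x v ≟ᵃ a))) (𝕐.words (n * q)) (weight A B x)))

  rowWeight>0⇒A : ∀ {A B x} → 0 < rowWeight A B x → T (A x)
  rowWeight>0⇒A {A} {B} {x} gt = 𝟙>0⇒T {A x} (m*n>0⇒m>0 (𝟙 (A x))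
    (subst (0 <_) (sym (*-distribˡ-∑ (𝟙 (A x)) (𝕐.words (n * q)) (λ y → 𝟙 (B y) * 𝕐.matches (zeros x) y))) gt))

  AgreesOn : List (Fin n) → X → (X → Bool) → Set
  AgreesOn I α A = ∀ x → T (A x) → ∀ v → v ∈ₗ I → lookup x v ≡ lookup α v

  AllZero : (X → Bool) → (Y → Bool) → Set
  AllZero A B = ∀ x y → T (A x) → T (B y) → lifted (x , y) ≡ false

  Certificate : (Fin n → Bool) → List (Fin n) → Set
  Certificate z C = ∀ z′ → (∀ {v} → v ∈ₗ C → z′ v ≡ z v) → f z′ ≡ true

  -- At the all-false input f has no 0-certificate with fewer than K cells.
  HardAtZero : ℕ → ℕ → Set
  HardAtZero k K = ∀ I → length I < K →
    ∃ λ z → (∀ {v} → v ∈ₗ I → z v ≡ false) × (∃ λ C → length C ≤ k × Certificate z C)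

  -- `τ-large` lets `pick` supply `2 ^ k * D` rows differing pairwise on `k` cells. At most one
  -- column in `2 ^ D` avoids all their patterns, and `D-large` lets this saving absorb both `2 ^ n`
  -- and `q ^ K`.
  module LowerBound (k K D : ℕ) (τ : ℕ) (hard : HardAtZero k K)
                    (D-large : 2 ^ n * q ^ K ≤ 2 ^ D)
                    (τ-large : 2 ^ k * D * k < τ) where

    open DecMem (Finₚ._≟_ {n}) using (_∉?_; _∈?_)

    -- Prescribed addresses on `I` leave at most one row in `q ^ length I`, and in each row only one
    -- column in `2 ^ n` gives all-false answers.
    base : ∀ {A} B {I α} → Unique I → AgreesOn I α A →
           2 ^ n * (mass A B * q ^ length I) ≤ q ^ n * 2 ^ (n * q)
    base {A} B {I} {α} uniq agrees = begin
      2 ^ n * (mass A B * q ^ length I)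
        ≡⟨ solve 3 (λ a b c → a :* (b :* c) := c :* (a :* b)) refl (2 ^ n) (mass A B) (q ^ length I) ⟩
      q ^ length I * (2 ^ n * mass A B)
        ≤⟨ *-monoʳ-≤ (q ^ length I) rows≤ ⟩
      q ^ length I * (2 ^ (n * q) * ∑ (𝕏.words n) (𝕏.matches P))
        ≡⟨ solve 3 (λ a b c → a :* (b :* c) := (a :* c) :* b) refl (q ^ length I) (2 ^ (n * q)) (∑ (𝕏.words n) (𝕏.matches P)) ⟩
      q ^ length I * ∑ (𝕏.words n) (𝕏.matches P) * 2 ^ (n * q)
        ≡⟨ cong (_* 2 ^ (n * q)) (count-agreeing uniq α) ⟩
      q ^ n * 2 ^ (n * q) ∎
      where
      open ≤-Reasoning
      P : List (Fin n × Fin q)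
      P = map (λ v → v , lookup α v) I

      A≤matches : ∀ x → 𝟙 (A x) ≤ 𝕏.matches P x
      A≤matches x with A x in eq
      ... | false = z≤n
      ... | true  = ≤-reflexive (sym (𝕏.matches-all
              (Allₚ.map⁺ (All.tabulate λ {v} → agrees x (subst T (sym eq) tt) v))))

      row≤ : ∀ x → 2 ^ n * rowWeight A B x ≤ 2 ^ (n * q) * 𝕏.matches P x
      row≤ x = begin
        2 ^ n * rowWeight A B x
          ≤⟨ *-monoʳ-≤ (2 ^ n) (∑-mono (𝕐.words (n * q)) (weight≤matches A B x)) ⟩
        2 ^ n * ∑ (𝕐.words (n * q)) (λ y → 𝟙 (A x) * 𝕐.matches (zeros x) y)
          ≡⟨ cong (2 ^ n *_) (*-distribˡ-∑ (𝟙 (A x)) (𝕐.words (n * q)) _) ⟨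
        2 ^ n * (𝟙 (A x) * ∑ (𝕐.words (n * q)) (𝕐.matches (zeros x)))
          ≡⟨ solve 3 (λ a b c → a :* (b :* c) := (a :* c) :* b) refl (2 ^ n) (𝟙 (A x)) (∑ (𝕐.words (n * q)) (𝕐.matches (zeros x))) ⟩
        2 ^ n * ∑ (𝕐.words (n * q)) (𝕐.matches (zeros x)) * 𝟙 (A x)
          ≡⟨ cong (_* 𝟙 (A x)) (count-zeros x) ⟩
        2 ^ (n * q) * 𝟙 (A x)
          ≤⟨ *-monoʳ-≤ (2 ^ (n * q)) (A≤matches x) ⟩
        2 ^ (n * q) * 𝕏.matches P x ∎

      rows≤ : 2 ^ n * mass A B ≤ 2 ^ (n * q) * ∑ (𝕏.words n) (𝕏.matches P)
      rows≤ = begin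
        2 ^ n * mass A B                                     ≡⟨ *-distribˡ-∑ (2 ^ n) (𝕏.words n) _ ⟩
        ∑ (𝕏.words n) (λ x → 2 ^ n * rowWeight A B x)        ≤⟨ ∑-mono (𝕏.words n) row≤ ⟩
        ∑ (𝕏.words n) (λ x → 2 ^ (n * q) * 𝕏.matches P x)    ≡⟨ *-distribˡ-∑ (2 ^ (n * q)) (𝕏.words n) _ ⟨
        2 ^ (n * q) * ∑ (𝕏.words n) (𝕏.matches P)            ∎

    -- If no single address carries a 1/τ fraction of the mass, then A contains
    -- many rows whose patterns live on disjoint cells, and B misses them all.
    spread-bound : ∀ {A B I α} → AgreesOn I α A → AllZero A B →
                   ∀ {z} → (∀ {v} → v ∈ₗ I → z v ≡ false) →
                   ∀ C → Certificate z C → ∀ C′ → Unique C′ → length C′ ≤ k →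
                   (∀ {v} → v ∈ₗ C → v ∉ I → v ∈ₗ C′) →
                   (∀ {v} → v ∈ₗ C′ → ∀ a → τ * mass (restrict v a A) B ≤ mass A B) →
                   2 ^ n * (mass A B * q ^ K) ≤ q ^ n * 2 ^ (n * q)
    spread-bound {A} {B} {I} {α} agrees avoid {z} z-I C cert C′ uniq len C⊆ spread with mass A B in eq
    ... | zero  = ≤-trans (≤-reflexive (*-zeroʳ (2 ^ n))) z≤n
    ... | suc _ = subst (λ M → 2 ^ n * (M * q ^ K) ≤ q ^ n * 2 ^ (n * q)) eq bound
      where
      open ≤-Reasoning

      L : ℕ
      L = 2 ^ length C′

      L≡ : 2 ^ length C′ ≡ suc (pred L)
      L≡ = sym (suc-pred L {{m^n≢0 2 (length C′)}})

      enough : suc (pred L) * D * length C′ < τ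
      enough = ≤-<-trans (*-mono-≤ (*-monoˡ-≤ D (≤-trans (≤-reflexive (sym L≡)) (^-monoʳ-≤ 2 len))) len) τ-large

      picked : ∃ λ xs → length xs ≡ suc (pred L) * D × All (λ x → 0 < rowWeight A B x) xs × AllPairs (DifferOn C′) xs
      picked = pick (rowWeight A B) C′ τ
        (λ {v} v∈ a → subst₂ _≤_ (cong (τ *_) (∑-cong (𝕏.words n) (rowWeight-restrict v a A B))) (sym eq) (spread v∈ a))
        (subst (0 <_) (sym eq) z<s) (suc (pred L) * D) enough

      xs : List X
      xs = proj₁ picked

      Ps : List (Pattern (n * q))
      Ps = map (demand C′ z) xs

      S : ℕ
      S = ∑ (𝕐.words (n * q)) (avoids Ps)

      few : 2 ^ D * S ≤ 2 ^ (n * q)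
      few = few-avoid (pred L) (length C′) L≡ D Ps
        (trans (Listₚ.length-map _ xs) (proj₁ (proj₂ picked)))
        (Allₚ.map⁺ (All.tabulate λ _ → Listₚ.length-map _ C′))
        (Allₚ.map⁺ (All.tabulate λ {x} _ → pattern-unique z x uniq))
        (AllPairsₚ.map⁺ (AllPairs.map (λ {x} {x′} → pattern-apart C′ z {x} {x′}) (proj₂ (proj₂ (proj₂ picked)))))

      -- A column of `B` matching the pattern of a picked row `x′` would make `x′` answer according
      -- to the certificate, which puts a one inside `A × B`. So only avoiding columns can have
      -- positive weight.
      weight≤avoids : ∀ x y → weight A B x y ≤ avoids Ps y
      weight≤avoids x y with avoids Ps y in eqA
      ... | suc _ = ≤-trans (weight≤1 A B x y) (s≤s z≤n)
      ... | zero  = ≮⇒≥ λ w>0 → contradicts w>0 (avoids≡0⇒match Ps eqA)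
        where
        contradicts : 0 < weight A B x y → ¬ (∃ λ P → P ∈ₗ Ps × 𝕐.matches P y ≢ 0)
        contradicts w>0 (P , P∈ , m≢0) with Memₚ.∈-map⁻ (demand C′ z) P∈
        ... | x′ , x′∈ , refl = contradiction (trans (sym (cert (answers x′ y) on-C)) (avoid x′ y Ax′ By)) λ ()
          where
          Ax′ : T (A x′)
          Ax′ = rowWeight>0⇒A {A} {B} (All.lookup (proj₁ (proj₂ (proj₂ picked))) x′∈)
          Ax : T (A x)
          Ax = 𝟙>0⇒T (m*n>0⇒m>0 (𝟙 (A x)) w>0)
          By : T (B y)
          By = 𝟙>0⇒T (m*n>0⇒m>0 (𝟙 (B y)) (m*n>0⇒n>0 (𝟙 (A x)) w>0))
          zero-xy : ∀ v → answers x y v ≡ false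
          zero-xy = zeros⇒answers x (m*n>0⇒n>0 (𝟙 (B y)) (m*n>0⇒n>0 (𝟙 (A x)) w>0))
          on-C : ∀ {v} → v ∈ₗ C → answers x′ y v ≡ z v
          on-C {v} v∈ with v ∈? I
          ... | no  v∉I = matches⇒answers C′ z {x′} m≢0 (C⊆ v∈ v∉I)
          -- On `I` all rows of `A` share their addresses, so `x′` reads the same bit as `x`, namely
          -- false, and this is what `z` prescribes there.
          ... | yes v∈I = trans (cong (λ a → lookup y (combine v a)) (trans (agrees x′ Ax′ v v∈I) (sym (agrees x Ax v v∈I))))
                                (trans (zero-xy v) (sym (z-I v∈I)))

      mass≤ : mass A B ≤ q ^ n * S
      mass≤ = begin
        mass A B                      ≤⟨ ∑-mono (𝕏.words n) (λ x → ∑-mono (𝕐.words (n * q)) (weight≤avoids x)) ⟩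
        ∑ (𝕏.words n) (λ _ → S)       ≡⟨ ∑-const (𝕏.words n) S ⟩
        length (𝕏.words n) * S        ≡⟨ cong (_* S) (trans (𝕏.length-words n) (cong (_^ n) size-q≡q)) ⟩
        q ^ n * S                     ∎

      bound : 2 ^ n * (mass A B * q ^ K) ≤ q ^ n * 2 ^ (n * q)
      bound = begin
        2 ^ n * (mass A B * q ^ K)    ≤⟨ *-monoʳ-≤ (2 ^ n) (*-monoˡ-≤ (q ^ K) mass≤) ⟩
        2 ^ n * (q ^ n * S * q ^ K)   ≡⟨ solve 4 (λ a b c d → a :* (b :* c :* d) := (a :* d) :* (b :* c)) refl (2 ^ n) (q ^ n) S (q ^ K) ⟩
        2 ^ n * q ^ K * (q ^ n * S)   ≤⟨ *-monoˡ-≤ (q ^ n * S) D-large ⟩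
        2 ^ D * (q ^ n * S)           ≡⟨ solve 3 (λ a b c → a :* (b :* c) := b :* (a :* c)) refl (2 ^ D) (q ^ n) S ⟩
        q ^ n * (2 ^ D * S)           ≤⟨ *-monoʳ-≤ (q ^ n) few ⟩
        q ^ n * 2 ^ (n * q)           ∎

    restrict-agrees : ∀ {A I α v a} → AgreesOn I α A → v ∉ I → AgreesOn (v ∷ I) (α [ v ]≔ a) (restrict v a A)
    restrict-agrees {A} {I} {α} {v} {a} agrees v∉I x Ax _ (here refl) =
      trans (T-does (lookup x v ≟ᵃ a) (T-∧ˡ Ax)) (sym (Vecₚ.lookup∘update v α a))
    restrict-agrees {A} {I} {α} {v} {a} agrees v∉I x Ax u (there u∈) =
      trans (agrees x (T-∧ʳ {does (lookup x v ≟ᵃ a)} Ax) u u∈)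
            (sym (Vecₚ.lookup∘update′ (λ { refl → v∉I u∈ }) α a))

    -- Induction on the number `κ` of cells still to be fixed. A heavy address carries more than a
    -- `1 / τ` share of the mass, so restricting to it costs a factor below `τ`. Without a heavy
    -- address `spread-bound` finishes; with `K` cells fixed `base` does. Starting from `I = []`,
    -- the all-false pairs in the rectangle are at most a `(τ / q) ^ K` share of all such pairs.
    mass-bound : ∀ κ {A B I α} → Unique I → length I + κ ≡ K → AgreesOn I α A → AllZero A B →
                 2 ^ n * (mass A B * q ^ K) ≤ q ^ n * 2 ^ (n * q) * τ ^ κ
    mass-bound zero {A} {B} {I} {α} uniq len agrees _ =
      ≤-trans (subst (λ l → 2 ^ n * (mass A B * q ^ l) ≤ q ^ n * 2 ^ (n * q)) (trans (sym (+-identityʳ _)) len)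
                (base B {α = α} uniq agrees))
              (≤-reflexive (sym (*-identityʳ _)))
    mass-bound (suc κ) {A} {B} {I} {α} uniq len agrees avoid
      with hard I (subst (length I <_) len (m<m+n (length I) z<s))
    ... | z , z-I , C , C≤k , cert = result
      where
      C′ : List (Fin n)
      -- Cells of `I` are dropped because their addresses are fixed already, duplicates because
      -- patterns need distinct positions.
      C′ = filter (_∉? I) (deduplicate Finₚ._≟_ C)

      instance τ≢0 : NonZero τ
      τ≢0 = >-nonZero (≤-<-trans z≤n τ-large)

      result : 2 ^ n * (mass A B * q ^ K) ≤ q ^ n * 2 ^ (n * q) * τ ^ suc κ
      result with Any.any? (λ v → Any.any? (λ a → mass A B <? τ * mass (restrict v a A) B) (allFin q)) C′
      -- `spread-bound` gives the estimate without the factor `τ ^ suc κ`, so it is only weakened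
      -- here.
      ... | no ¬heavy = ≤-trans
            (spread-bound {α = α} agrees avoid z-I C cert C′
              (Uniqueₚ.filter⁺ (_∉? I) (DecUniqueₚ.deduplicate-! Finₚ._≟_ C))
              (≤-trans (Listₚ.length-filter (_∉? I) (deduplicate Finₚ._≟_ C)) (≤-trans (Listₚ.length-deduplicate Finₚ._≟_ C) C≤k))
              (λ v∈C v∉I → Memₚ.∈-filter⁺ (_∉? I) (Memₚ.∈-deduplicate⁺ Finₚ._≟_ v∈C) v∉I)
              (λ v∈ a → ≮⇒≥ λ heavy → ¬heavy (lose v∈ (lose (Memₚ.∈-allFin a) heavy))))
            (m≤m*n _ (τ ^ suc κ) {{m^n≢0 τ (suc κ)}})
      ... | yes heavy with v , v∈ , heavy′ ← find heavy with a , _ , M< ← find heavy′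
                      with _ , v∉I ← Memₚ.∈-filter⁻ (_∉? I) {xs = deduplicate Finₚ._≟_ C} v∈ = begin
        2 ^ n * (mass A B * q ^ K)
          ≤⟨ *-monoʳ-≤ (2 ^ n) (*-monoˡ-≤ (q ^ K) (<⇒≤ M<)) ⟩
        2 ^ n * (τ * mass (restrict v a A) B * q ^ K)
          ≡⟨ solve 4 (λ b t m r → b :* (t :* m :* r) := t :* (b :* (m :* r))) refl (2 ^ n) τ (mass (restrict v a A) B) (q ^ K) ⟩
        τ * (2 ^ n * (mass (restrict v a A) B * q ^ K))
          ≤⟨ *-monoʳ-≤ τ (mass-bound κ {α = α [ v ]≔ a} (All.tabulate (λ {u} u∈ v≡u → v∉I (subst (_∈ₗ I) (sym v≡u) u∈)) ∷ uniq)
               (trans (sym (+-suc (length I) κ)) len) (restrict-agrees {α = α} agrees v∉I)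
               (λ x y Ax → avoid x y (T-∧ʳ {does (lookup x v ≟ᵃ a)} Ax))) ⟩
        τ * (q ^ n * 2 ^ (n * q) * τ ^ κ)
          ≡⟨ solve 3 (λ t c p → t :* (c :* p) := c :* (t :* p)) refl τ (q ^ n * 2 ^ (n * q)) (τ ^ κ) ⟩
        q ^ n * 2 ^ (n * q) * (τ * τ ^ κ) ∎
        where open ≤-Reasoning

    -- Every all-false pair is a zero and hence covered, so the masses of the rectangles add up to
    -- at least `Z`, while each is at most a `(τ / q) ^ K` share of `Z`.
    cover-bound : (∀ z → (∀ v → z v ≡ false) → f z ≡ false) → .{{_ : NonZero q}} →
                  ∀ {c} (R : Fin c → Rectangle X Y) → Covers R (lifted ⁻¹ false) → q ^ K ≤ c * τ ^ K
    cover-bound zero-value {c} R (inside , outside) = *-cancelˡ-≤ pairs {{pairs≢0}} (begin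
      pairs * q ^ K
        ≡⟨ cong (_* q ^ K) count ⟨
      2 ^ n * Z * q ^ K
        ≡⟨ *-assoc (2 ^ n) Z (q ^ K) ⟩
      2 ^ n * (Z * q ^ K)
        ≤⟨ *-monoʳ-≤ (2 ^ n) (*-monoˡ-≤ (q ^ K) Z≤) ⟩
      2 ^ n * (∑ (allFin c) (λ i → mass (rows (R i)) (columns (R i))) * q ^ K)
        ≡⟨ cong (2 ^ n *_) (trans (*-comm _ (q ^ K)) (*-distribˡ-∑ (q ^ K) (allFin c) _)) ⟩
      2 ^ n * ∑ (allFin c) (λ i → q ^ K * mass (rows (R i)) (columns (R i)))
        ≡⟨ *-distribˡ-∑ (2 ^ n) (allFin c) _ ⟩
      ∑ (allFin c) (λ i → 2 ^ n * (q ^ K * mass (rows (R i)) (columns (R i))))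
        ≤⟨ ∑-mono (allFin c) rectangle ⟩
      ∑ (allFin c) (λ _ → pairs * τ ^ K)
        ≡⟨ trans (∑-const (allFin c) _) (cong (_* (pairs * τ ^ K)) (Listₚ.length-tabulate {n = c} id)) ⟩
      c * (pairs * τ ^ K)
        ≡⟨ solve 3 (λ a b d → a :* (b :* d) := b :* (a :* d)) refl c pairs (τ ^ K) ⟩
      pairs * (c * τ ^ K) ∎)
      where
      open ≤-Reasoning
      open Rectangle

      pairs Z : ℕ
      pairs = q ^ n * 2 ^ (n * q)
      Z = ∑ (𝕏.words n) λ x → ∑ (𝕐.words (n * q)) (𝕐.matches (zeros x))

      pairs≢0 : NonZero pairs
      pairs≢0 = m*n≢0 (q ^ n) (2 ^ (n * q)) {{m^n≢0 q n}} {{m^n≢0 2 (n * q)}}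

      count : 2 ^ n * Z ≡ pairs
      count = trans (*-distribˡ-∑ (2 ^ n) (𝕏.words n) _) (trans (∑-cong (𝕏.words n) count-zeros)
        (trans (∑-const (𝕏.words n) _) (cong (_* 2 ^ (n * q)) (trans (𝕏.length-words n) (cong (_^ n) size-q≡q)))))

      pointwise : ∀ x y → 𝕐.matches (zeros x) y ≤ ∑ (allFin c) (λ i → weight (rows (R i)) (columns (R i)) x y)
      pointwise x y with 𝕐.matches (zeros x) y in eq
      ... | zero  = z≤n
      ... | suc m with outside {x , y} (sym (zero-value (answers x y) (zeros⇒answers x (subst (0 <_) (sym eq) z<s))))
      ...   | i , x∈ , y∈ = ≤-trans (≤-reflexive (sym (trans
                (cong₂ (λ a b → a * (b * suc m)) (T⇒𝟙≡1 x∈) (T⇒𝟙≡1 y∈)) (trans (*-identityˡ _) (*-identityˡ _)))))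
              (f≤∑ (λ i → 𝟙 (rows (R i) x) * (𝟙 (columns (R i) y) * suc m)) (Memₚ.∈-allFin i))

      Z≤ : Z ≤ ∑ (allFin c) (λ i → mass (rows (R i)) (columns (R i)))
      Z≤ = begin
        Z
          ≤⟨ ∑-mono (𝕏.words n) (λ x → ∑-mono (𝕐.words (n * q)) (pointwise x)) ⟩
        ∑ (𝕏.words n) (λ x → ∑ (𝕐.words (n * q)) λ y → ∑ (allFin c) λ i → weight (rows (R i)) (columns (R i)) x y)
          ≡⟨ ∑-cong (𝕏.words n) (λ x → ∑-swap (𝕐.words (n * q)) (allFin c) _) ⟩
        ∑ (𝕏.words n) (λ x → ∑ (allFin c) λ i → rowWeight (rows (R i)) (columns (R i)) x)
          ≡⟨ ∑-swap (𝕏.words n) (allFin c) _ ⟩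
        ∑ (allFin c) (λ i → mass (rows (R i)) (columns (R i))) ∎

      rectangle : ∀ i → 2 ^ n * (q ^ K * mass (rows (R i)) (columns (R i))) ≤ pairs * τ ^ K
      rectangle i = ≤-trans (≤-reflexive (cong (2 ^ n *_) (*-comm (q ^ K) _)))
        (mass-bound K {I = []} {α = Vec.replicate n a₀} [] refl (λ _ _ _ ()) (λ x y x∈ y∈ → sym (inside (i , x∈ , y∈))))
        where
        a₀ : Fin q
        a₀ = Fin.fromℕ< (>-nonZero⁻¹ q)

-- Decision trees

data DTree (n : ℕ) : Set where
  leaf : Bool → DTree n
  node : Fin n → (t₀ t₁ : DTree n) → DTree n

module _ {n : ℕ} where

  depth : DTree n → ℕ
  depth (leaf b)       = 0
  depth (node v t₀ t₁) = suc (depth t₀ ⊔ depth t₁)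

  eval : DTree n → (Fin n → Bool) → Bool
  eval (leaf b)       z = b
  eval (node v t₀ t₁) z = if z v then eval t₁ z else eval t₀ z

  path : DTree n → (Fin n → Bool) → List (Fin n)
  path (leaf b)       z = []
  path (node v t₀ t₁) z = v ∷ (if z v then path t₁ z else path t₀ z)

  length-path : ∀ t z → length (path t z) ≤ depth t
  length-path (leaf b)       z = z≤n
  length-path (node v t₀ t₁) z with z v
  ... | true  = s≤s (≤-trans (length-path t₁ z) (m≤n⊔m (depth t₀) (depth t₁)))
  ... | false = s≤s (≤-trans (length-path t₀ z) (m≤m⊔n (depth t₀) (depth t₁)))

  -- The queried cells form a certificate: an input agreeing on them follows the same branch.
  eval-path : ∀ t z z′ → (∀ {v} → v ∈ₗ path t z → z′ v ≡ z v) → eval t z′ ≡ eval t z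
  eval-path (leaf b)       z z′ agree = refl
  eval-path (node v t₀ t₁) z z′ agree rewrite agree (here refl) with z v
  ... | true  = eval-path t₁ z z′ (agree ∘ there)
  ... | false = eval-path t₀ z z′ (agree ∘ there)

-- Disjoint rectangles from decision trees

module _ {X Y : Set} where

  open Rectangle

  -- Numerical membership, so that the single identity `∑ Rs (hits x y) ≡ 𝟙 (F (x , y))` yields both
  -- covering and disjointness.
  hits : X → Y → Rectangle X Y → ℕ
  hits x y R = 𝟙 (rows R x) * 𝟙 (columns R y)

  hits⇒∈ : ∀ {x y} R → 0 < hits x y R → ⟦ R ⟧ (x , y)
  hits⇒∈ {x} R gt = 𝟙>0⇒T (m*n>0⇒m>0 (𝟙 (rows R x)) gt) , 𝟙>0⇒T (m*n>0⇒n>0 (𝟙 (rows R x)) gt)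

  ∈⇒hits : ∀ {x y} R → ⟦ R ⟧ (x , y) → hits x y R ≡ 1
  ∈⇒hits R (x∈ , y∈) = cong₂ _*_ (T⇒𝟙≡1 x∈) (T⇒𝟙≡1 y∈)

two-terms≤∑ : ∀ (xs : List A) (f : A → ℕ) {i j} → i ≢ j → f (List.lookup xs i) + f (List.lookup xs j) ≤ ∑ xs f
two-terms≤∑ (x ∷ xs) f {Fin.zero}  {Fin.zero}  i≢j = contradiction refl i≢j
two-terms≤∑ (x ∷ xs) f {Fin.zero}  {Fin.suc j} i≢j = +-monoʳ-≤ (f x) (f≤∑ f (Memₚ.∈-lookup {xs = xs} j))
two-terms≤∑ (x ∷ xs) f {Fin.suc i} {Fin.zero}  i≢j =
  ≤-trans (≤-reflexive (+-comm _ (f x))) (+-monoʳ-≤ (f x) (f≤∑ f (Memₚ.∈-lookup {xs = xs} i)))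
two-terms≤∑ (x ∷ xs) f {Fin.suc i} {Fin.suc j} i≢j =
  ≤-trans (two-terms≤∑ xs f (i≢j ∘ cong Fin.suc)) (m≤n+m _ (f x))

∑>0⇒index : ∀ (xs : List A) (f : A → ℕ) → 0 < ∑ xs f → ∃ λ i → 0 < f (List.lookup xs i)
∑>0⇒index (x ∷ xs) f gt with f x in eq
... | suc _ = Fin.zero , subst (0 <_) (sym eq) z<s
... | zero  = let i , gt′ = ∑>0⇒index xs f gt in Fin.suc i , gt′

lookup-disjoint : ∀ {X Y : Set} (Rs : List (Rectangle X Y)) → (∀ x y → ∑ Rs (hits x y) ≤ 1) →
                  PairwiseDisjoint (List.lookup Rs)
lookup-disjoint Rs once {i} {j} i≢j {x , y} (p , q) = <⇒≱ (s≤s (once x y))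
  (subst₂ (λ a b → a + b ≤ ∑ Rs (hits x y)) (∈⇒hits (List.lookup Rs i) p) (∈⇒hits (List.lookup Rs j) q)
    (two-terms≤∑ Rs (hits x y) i≢j))

lookup-covers : ∀ {X Y : Set} (F : TwoParty X Y) (Rs : List (Rectangle X Y)) →
                (∀ x y → ∑ Rs (hits x y) ≡ 𝟙 (F (x , y))) → Covers (List.lookup Rs) (F ⁻¹ true)
lookup-covers F Rs mult = inside , outside
  where
  inside : ∀ {p} → _ → true ≡ F p
  inside {x , y} (i , p) with F (x , y) | mult x y
  ... | true  | _  = refl
  ... | false | eq = contradiction (subst₂ _≤_ (∈⇒hits (List.lookup Rs i) p) eq (f≤∑ (hits x y) (Memₚ.∈-lookup {xs = Rs} i))) λ ()
  outside : ∀ {p} → true ≡ F p → _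
  outside {x , y} F≡ = let i , gt = ∑>0⇒index Rs (hits x y)
                             (≤-reflexive (sym (trans (mult x y) (cong 𝟙 (sym F≡)))))
                       in i , hits⇒∈ (List.lookup Rs i) gt

module TreeRectangles (n q : ℕ) where

  open Index n q
  open Alphabet (finAlphabet q) using (∑-point)

  guard : Fin n → Fin q → Bool → Rectangle X Y → Rectangle X Y
  guard v a b R = record
    { rows    = λ x → does (a Finₚ.≟ lookup x v) ∧ rows x
    ; columns = λ y → does (lookup y (combine v a) Boolₚ.≟ b) ∧ columns y
    }
    where open Rectangle R

  everything : Rectangle X Y
  everything = record { rows = λ _ → true ; columns = λ _ → true }

  -- A query splits the inputs by Alice's address and by Bob's bit at that address, a branching of
  -- `2 * q`. Only accepting leaves contribute.
  rectangles : DTree n → List (Rectangle X Y)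
  rectangles (leaf true)    = everything ∷ []
  rectangles (leaf false)   = []
  rectangles (node v t₀ t₁) =
    concatMap (λ a → map (guard v a false) (rectangles t₀) ++ map (guard v a true) (rectangles t₁)) (allFin q)

  ∑-guard : ∀ x y v a b Rs → ∑ (map (guard v a b) Rs) (hits x y) ≡
            𝟙 (does (a Finₚ.≟ lookup x v)) * (𝟙 (does (lookup y (combine v a) Boolₚ.≟ b)) * ∑ Rs (hits x y))
  ∑-guard x y v a b Rs = begin
    ∑ (map (guard v a b) Rs) (hits x y)         ≡⟨ ∑-map (guard v a b) Rs (hits x y) ⟩
    ∑ Rs (λ R → hits x y (guard v a b R))       ≡⟨ ∑-cong Rs (λ R → trans
        (cong₂ _*_ (𝟙-∧ α? (rows R x)) (𝟙-∧ β? (columns R y)))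
        (solve 4 (λ a r b c → (a :* r) :* (b :* c) := a :* (b :* (r :* c))) refl (𝟙 α?) (𝟙 (rows R x)) (𝟙 β?) (𝟙 (columns R y)))) ⟩
    ∑ Rs (λ R → 𝟙 α? * (𝟙 β? * hits x y R))     ≡⟨ *-distribˡ-∑ (𝟙 α?) Rs _ ⟨
    𝟙 α? * ∑ Rs (λ R → 𝟙 β? * hits x y R)       ≡⟨ cong (𝟙 α? *_) (*-distribˡ-∑ (𝟙 β?) Rs _) ⟨
    𝟙 α? * (𝟙 β? * ∑ Rs (hits x y))             ∎
    where
    open ≡-Reasoning
    open Rectangle
    α? β? : Bool
    α? = does (a Finₚ.≟ lookup x v)
    β? = does (lookup y (combine v a) Boolₚ.≟ b)

  rectangles-multiplicity : ∀ t x y → ∑ (rectangles t) (hits x y) ≡ 𝟙 (eval t (answers x y))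
  rectangles-multiplicity (leaf true)    x y = refl
  rectangles-multiplicity (leaf false)   x y = refl
  rectangles-multiplicity (node v t₀ t₁) x y = begin
    ∑ (rectangles (node v t₀ t₁)) (hits x y)
      ≡⟨ ∑-concatMap _ (allFin q) (hits x y) ⟩
    ∑ (allFin q) (λ a → ∑ (map (guard v a false) (rectangles t₀) ++ map (guard v a true) (rectangles t₁)) (hits x y))
      ≡⟨ ∑-cong (allFin q) branch ⟩
    ∑ (allFin q) (λ a → 𝟙 (does (a Finₚ.≟ lookup x v)) * chosen (lookup y (combine v a)))
      ≡⟨ ∑-point (lookup x v) (λ a → chosen (lookup y (combine v a))) ⟩
    chosen (answers x y v)
      ≡⟨ choose (answers x y v) ⟩
    𝟙 (eval (node v t₀ t₁) (answers x y)) ∎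
    where
    open ≡-Reasoning
    s₀ s₁ : ℕ
    s₀ = ∑ (rectangles t₀) (hits x y)
    s₁ = ∑ (rectangles t₁) (hits x y)

    chosen : Bool → ℕ
    chosen b = 𝟙 (does (b Boolₚ.≟ false)) * s₀ + 𝟙 (does (b Boolₚ.≟ true)) * s₁

    branch : ∀ a → ∑ (map (guard v a false) (rectangles t₀) ++ map (guard v a true) (rectangles t₁)) (hits x y) ≡
             𝟙 (does (a Finₚ.≟ lookup x v)) * chosen (lookup y (combine v a))
    branch a = trans (∑-++ (map (guard v a false) (rectangles t₀)) _ (hits x y))
      (trans (cong₂ _+_ (∑-guard x y v a false (rectangles t₀)) (∑-guard x y v a true (rectangles t₁)))
             (sym (*-distribˡ-+ (𝟙 (does (a Finₚ.≟ lookup x v))) _ _)))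

    choose : ∀ b → chosen b ≡ 𝟙 (if b then eval t₁ (answers x y) else eval t₀ (answers x y))
    choose true  = trans (+-identityʳ _) (rectangles-multiplicity t₁ x y)
    choose false = trans (+-identityʳ _) (trans (+-identityʳ _) (rectangles-multiplicity t₀ x y))

  length-rectangles : .{{_ : NonZero q}} → ∀ t d → depth t ≤ d → length (rectangles t) ≤ (2 * q) ^ d
  length-rectangles (leaf true)  d _ = m^n>0 (2 * q) {{m*n≢0 2 q}} d
  length-rectangles (leaf false) d _ = z≤n
  length-rectangles (node v t₀ t₁) (suc d) (s≤s le) = begin
    length (rectangles (node v t₀ t₁))
      ≡⟨ length-as-∑ (rectangles (node v t₀ t₁)) ⟨
    ∑ (rectangles (node v t₀ t₁)) (λ _ → 1)
      ≡⟨ ∑-concatMap _ (allFin q) _ ⟩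
    ∑ (allFin q) (λ a → ∑ (map (guard v a false) (rectangles t₀) ++ map (guard v a true) (rectangles t₁)) (λ _ → 1))
      ≡⟨ ∑-cong (allFin q) (λ a → trans (length-as-∑ (map (guard v a false) (rectangles t₀) ++ map (guard v a true) (rectangles t₁)))
           (trans (Listₚ.length-++ (map (guard v a false) (rectangles t₀)))
                  (cong₂ _+_ (Listₚ.length-map (guard v a false) (rectangles t₀)) (Listₚ.length-map (guard v a true) (rectangles t₁))))) ⟩
    ∑ (allFin q) (λ _ → length (rectangles t₀) + length (rectangles t₁))
      ≤⟨ ∑-mono (allFin q) (λ _ → +-mono-≤ (length-rectangles t₀ d (≤-trans (m≤m⊔n (depth t₀) (depth t₁)) le))
                                           (length-rectangles t₁ d (≤-trans (m≤n⊔m (depth t₀) (depth t₁)) le))) ⟩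
    ∑ (allFin q) (λ _ → (2 * q) ^ d + (2 * q) ^ d)
      ≡⟨ trans (∑-const (allFin q) _) (cong (_* ((2 * q) ^ d + (2 * q) ^ d)) (Listₚ.length-tabulate {n = q} id)) ⟩
    q * ((2 * q) ^ d + (2 * q) ^ d)
      ≡⟨ solve 2 (λ q p → q :* (p :+ p) := con 2 :* q :* p) refl q ((2 * q) ^ d) ⟩
    2 * q * (2 * q) ^ d ∎
    where open ≤-Reasoning

∑-at-most-one : ∀ n (b : Fin n → Bool) → (∀ {i j} → T (b i) → T (b j) → i ≡ j) → ∑ (allFin n) (𝟙 ∘ b) ≤ 1
∑-at-most-one n b uniq with Finₚ.any? (λ i → Boolₚ.T? (b i))
... | no none = ≤-trans (∑-mono (allFin n) (λ i → none⇒0 (b i) (λ t → none (i , t))))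
                  (≤-trans (≤-reflexive (trans (∑-const (allFin n) 0) (*-zeroʳ (length (allFin n))))) z≤n)
  where
  none⇒0 : ∀ b → ¬ T b → 𝟙 b ≤ 0
  none⇒0 true  ¬t = contradiction tt ¬t
  none⇒0 false _  = z≤n
... | yes (i , ti) = ≤-trans (∑-mono (allFin n) only) (≤-reflexive (∑-point i (λ _ → 1)))
  where
  open Alphabet (finAlphabet n) using (∑-point)
  only : ∀ j → 𝟙 (b j) ≤ 𝟙 (does (j Finₚ.≟ i)) * 1
  only j with b j in eq
  ... | false = z≤n
  ... | true  = ≤-reflexive (sym (cong (_* 1) (𝟙-yes (j Finₚ.≟ i) (uniq (subst T (sym eq) tt) ti))))

∑-filter-≤ : ∀ {P : A → Set} (P? : Decidable P) (xs : List A) (f : A → ℕ) → ∑ (filter P? xs) f ≤ ∑ xs f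
∑-filter-≤ P? []       f = z≤n
∑-filter-≤ P? (x ∷ xs) f with does (P? x)
... | true  = +-monoʳ-≤ (f x) (∑-filter-≤ P? xs f)
... | false = ≤-trans (∑-filter-≤ P? xs f) (m≤n+m _ (f x))

-- The query function

-- The cells form an N × (N + w) matrix: row i holds the edge bits of i to all
-- j (the diagonal ones are never read), followed by the w patch bits of i.

module Source (N w : ℕ) where

  -- `certificateSize` allows for `N` incoming edges, `w` patch bits, `N` outgoing edges, and `w`
  -- patch bits at each of `w` absent edges.
  cells certificateSize : ℕ
  cells = N * (N + w)
  certificateSize = N + (w + (N + w * w))

  edge : Fin N → Fin N → Fin cells
  edge i j = combine i (j Fin.↑ˡ w)

  patch : Fin N → Fin w → Fin cells
  patch i r = combine i (N Fin.↑ʳ r)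

  owner : Fin cells → Fin N
  owner v = proj₁ (Fin.remQuot {N} (N + w) v)

  owner-combine : ∀ i (j : Fin (N + w)) → owner (combine i j) ≡ i
  owner-combine i j = cong proj₁ (Finₚ.remQuot-combine i j)

  others : Fin N → List (Fin N)
  others i = filter (λ j → ¬? (j Finₚ.≟ i)) (allFin N)

  ∈-others : ∀ {i j} → j ≢ i → j ∈ₗ others i
  ∈-others {i} {j} j≢i = Memₚ.∈-filter⁺ (λ j → ¬? (j Finₚ.≟ i)) (Memₚ.∈-allFin j) j≢i

  others-≢ : ∀ {i j} → j ∈ₗ others i → j ≢ i
  others-≢ {i} j∈ = proj₂ (Memₚ.∈-filter⁻ (λ j → ¬? (j Finₚ.≟ i)) {xs = allFin N} j∈)

  patches : Fin N → List (Fin cells)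
  patches i = map (patch i) (allFin w)

  incoming : Fin N → List (Fin cells)
  incoming i = map (λ j → edge j i) (others i)

  -- Continuation style: `t` is the test that runs once the check of the listed cells has passed.
  allFalse someTrue : List (Fin cells) → DTree cells → DTree cells
  allFalse []       t = t
  allFalse (v ∷ vs) t = node v (allFalse vs t) (leaf false)
  someTrue []       t = leaf false
  someTrue (v ∷ vs) t = node v (someTrue vs t) t

  -- The counter `b` is the number of absent edges still permitted; each one met uses up a unit and
  -- triggers a check of the patches at its endpoint.
  outgoing : Fin N → List (Fin N) → ℕ → DTree cells
  outgoing i []       b       = leaf true
  outgoing i (j ∷ js) zero    = node (edge i j) (leaf false) (outgoing i js zero)
  outgoing i (j ∷ js) (suc b) = node (edge i j) (allFalse (patches j) (outgoing i js b)) (outgoing i js (suc b))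

  isSource : Fin N → DTree cells
  isSource i = allFalse (incoming i) (someTrue (patches i) (outgoing i (others i) w))

  depth-allFalse : ∀ vs t → depth (allFalse vs t) ≤ length vs + depth t
  depth-allFalse []       t = ≤-refl
  depth-allFalse (v ∷ vs) t = s≤s (⊔-lub (depth-allFalse vs t) z≤n)

  depth-someTrue : ∀ vs t → depth (someTrue vs t) ≤ length vs + depth t
  depth-someTrue []       t = z≤n
  depth-someTrue (v ∷ vs) t = s≤s (⊔-lub (depth-someTrue vs t) (m≤n+m (depth t) (length vs)))

  length-patches : ∀ i → length (patches i) ≡ w
  length-patches i = trans (Listₚ.length-map (patch i) (allFin w)) (Listₚ.length-tabulate {n = w} id)

  length-others : ∀ i → length (others i) ≤ N
  length-others i = ≤-trans (Listₚ.length-filter (λ j → ¬? (j Finₚ.≟ i)) (allFin N))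
                            (≤-reflexive (Listₚ.length-tabulate {n = N} id))

  depth-outgoing : ∀ i js b → depth (outgoing i js b) ≤ length js + b * w
  depth-outgoing i []       b       = z≤n
  depth-outgoing i (j ∷ js) zero    = s≤s (depth-outgoing i js zero)
  depth-outgoing i (j ∷ js) (suc b) = s≤s (⊔-lub hole (depth-outgoing i js (suc b)))
    where
    open ≤-Reasoning
    hole : depth (allFalse (patches j) (outgoing i js b)) ≤ length js + (w + b * w)
    hole = begin
      depth (allFalse (patches j) (outgoing i js b))      ≤⟨ depth-allFalse (patches j) (outgoing i js b) ⟩
      length (patches j) + depth (outgoing i js b)        ≤⟨ +-mono-≤ (≤-reflexive (length-patches j)) (depth-outgoing i js b) ⟩
      w + (length js + b * w)                             ≡⟨ solve 3 (λ w l p → w :+ (l :+ p) := l :+ (w :+ p)) refl w (length js) (b * w) ⟩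
      length js + (w + b * w)                             ∎

  depth-isSource : ∀ i → depth (isSource i) ≤ certificateSize
  depth-isSource i = begin
    depth (isSource i)
      ≤⟨ depth-allFalse (incoming i) _ ⟩
    length (incoming i) + depth (someTrue (patches i) (outgoing i (others i) w))
      ≤⟨ +-mono-≤ (≤-trans (≤-reflexive (Listₚ.length-map (λ j → edge j i) (others i))) (length-others i))
                  (depth-someTrue (patches i) _) ⟩
    N + (length (patches i) + depth (outgoing i (others i) w))
      ≤⟨ +-monoʳ-≤ N (+-mono-≤ (≤-reflexive (length-patches i))
           (≤-trans (depth-outgoing i (others i) w) (+-monoˡ-≤ (w * w) (length-others i)))) ⟩
    N + (w + (N + w * w)) ∎
    where open ≤-Reasoning

  module _ (z : Fin cells → Bool) where

    allFalse-sound : ∀ vs t → T (eval (allFalse vs t) z) → (∀ {v} → v ∈ₗ vs → z v ≡ false) × T (eval t z)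
    allFalse-sound []       t acc = (λ ()) , acc
    allFalse-sound (v ∷ vs) t acc with z v in eq
    ... | false = let all , acc′ = allFalse-sound vs t acc in (λ { (here refl) → eq ; (there v∈) → all v∈ }) , acc′

    allFalse-complete : ∀ vs t → (∀ {v} → v ∈ₗ vs → z v ≡ false) → T (eval t z) → T (eval (allFalse vs t) z)
    allFalse-complete []       t all acc = acc
    allFalse-complete (v ∷ vs) t all acc rewrite all (here refl) = allFalse-complete vs t (all ∘ there) acc

    someTrue-sound : ∀ vs t → T (eval (someTrue vs t) z) → (∃ λ v → v ∈ₗ vs × z v ≡ true) × T (eval t z)
    someTrue-sound (v ∷ vs) t acc with z v in eq
    ... | true  = (v , here refl , eq) , acc
    ... | false = let (u , u∈ , zu) , acc′ = someTrue-sound vs t acc in (u , there u∈ , zu) , acc′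

    someTrue-complete : ∀ {vs} t {v} → v ∈ₗ vs → z v ≡ true → T (eval t z) → T (eval (someTrue vs t) z)
    someTrue-complete {u ∷ vs} t v∈ zv acc with z u in eq
    ... | true  = acc
    ... | false with v∈
    ...   | here refl = contradiction (trans (sym eq) zv) λ ()
    ...   | there v∈′ = someTrue-complete t v∈′ zv acc

    outgoing-sound : ∀ i js b → T (eval (outgoing i js b) z) →
                     ∀ {j} → j ∈ₗ js → z (edge i j) ≡ false → ∀ {v} → v ∈ₗ patches j → z v ≡ false
    outgoing-sound i (j′ ∷ js) zero acc j∈ hole with z (edge i j′) in eq | j∈
    ... | true | here refl  = contradiction (trans (sym eq) hole) λ ()
    ... | true | there j∈js = outgoing-sound i js zero acc j∈js hole
    outgoing-sound i (j′ ∷ js) (suc b) acc j∈ hole with z (edge i j′) in eq | j∈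
    ... | true  | here refl  = contradiction (trans (sym eq) hole) λ ()
    ... | true  | there j∈js = outgoing-sound i js (suc b) acc j∈js hole
    ... | false | here refl  = proj₁ (allFalse-sound (patches j′) (outgoing i js b) acc)
    ... | false | there j∈js =
      outgoing-sound i js b (proj₂ (allFalse-sound (patches j′) (outgoing i js b) acc)) j∈js hole

    outgoing-complete : ∀ i js b → (∀ {j} → j ∈ₗ js → ∀ {v} → v ∈ₗ patches j → z v ≡ false) →
                        ∑ js (λ j → 𝟙 (not (z (edge i j)))) ≤ b → T (eval (outgoing i js b) z)
    outgoing-complete i []       b empty few = tt
    outgoing-complete i (j ∷ js) zero empty few with z (edge i j)
    ... | true = outgoing-complete i js zero (empty ∘ there) few
    outgoing-complete i (j ∷ js) (suc b) empty few with z (edge i j) | few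
    ... | true  | few′     = outgoing-complete i js (suc b) (empty ∘ there) few′
    ... | false | s≤s few′ =
      allFalse-complete (patches j) _ (empty (here refl)) (outgoing-complete i js b (empty ∘ there) few′)

    isSource-sound : ∀ i → T (eval (isSource i) z) →
      (∀ {j} → j ≢ i → z (edge j i) ≡ false) ×
      (∃ λ v → v ∈ₗ patches i × z v ≡ true) ×
      (∀ {j} → j ≢ i → z (edge i j) ≡ false → ∀ {v} → v ∈ₗ patches j → z v ≡ false)
    isSource-sound i acc with allFalse-sound (incoming i) _ acc
    ... | no-in , acc₁ with someTrue-sound (patches i) _ acc₁
    ...   | some , acc₂ =
      (λ j≢i → no-in (Memₚ.∈-map⁺ (λ j → edge j i) (∈-others j≢i))) ,
      some ,
      (λ j≢i → outgoing-sound i (others i) w acc₂ (∈-others j≢i))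

    source-unique : ∀ {i j} → T (eval (isSource i) z) → T (eval (isSource j) z) → i ≡ j
    source-unique {i} {j} si sj with i Finₚ.≟ j
    ... | yes eq  = eq
    ... | no i≢j with isSource-sound i si | isSource-sound j sj
    ...   | _ , _ , holes | no-in , (v , v∈ , zv) , _ =
      contradiction (trans (sym zv) (holes (i≢j ∘ sym) (no-in i≢j) v∈)) λ ()

    sources : ℕ
    sources = ∑ (allFin N) (λ i → 𝟙 (eval (isSource i) z))

    sources≤1 : sources ≤ 1
    sources≤1 = ∑-at-most-one N (λ i → eval (isSource i) z) source-unique

  hasSource : (Fin cells → Bool) → Bool
  hasSource z = 0 <ᵇ sources z

  sources≡ : ∀ z → sources z ≡ 𝟙 (hasSource z)
  sources≡ z with sources z | sources≤1 z
  ... | zero        | _ = refl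
  ... | suc zero    | _ = refl
  ... | suc (suc _) | s≤s ()

  isSource⇒hasSource : ∀ z i → T (eval (isSource i) z) → hasSource z ≡ true
  isSource⇒hasSource z i acc = Boolₚ.T-≡ .Equivalence.to
    (<⇒<ᵇ (≤-trans (≤-reflexive (sym (T⇒𝟙≡1 acc))) (f≤∑ (λ i → 𝟙 (eval (isSource i) z)) (Memₚ.∈-allFin i))))

  hasSource-zero : ∀ z → (∀ v → z v ≡ false) → hasSource z ≡ false
  hasSource-zero z z≡0 with hasSource z in eq
  ... | false = refl
  ... | true  with ∑>0⇒index (allFin N) (λ i → 𝟙 (eval (isSource i) z)) (<ᵇ⇒< 0 _ (subst T (sym eq) tt))
  ...   | k , gt with isSource-sound z _ (𝟙>0⇒T gt)
  ...     | _ , (v , _ , zv) , _ = contradiction (trans (sym zv) (z≡0 v)) λ ()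

  -- Planting an accepting row outside a small set of fixed cells

  module _ (I : List (Fin cells)) where

    open DecMem (Finₚ._≟_ {cells}) using (_∈?_)

    ownedBy : Fin N → ℕ
    ownedBy i = ∑ I (λ v → 𝟙 (does (i Finₚ.≟ owner v)))

    ∑-ownedBy : ∑ (allFin N) ownedBy ≡ length I
    ∑-ownedBy = trans (∑-swap (allFin N) I _) (trans (∑-cong I λ v →
      trans (∑-cong (allFin N) λ i → sym (*-identityʳ _)) (∑-point (owner v) (λ _ → 1))) (length-as-∑ I))
      where open Alphabet (finAlphabet N) using (∑-point)

    exposed : length I < N * w → ∃ λ i → ownedBy i < w
    exposed lt with ∑-<⇒∃ (allFin N) {ownedBy} {λ _ → w}
      (subst₂ _<_ (sym ∑-ownedBy)
        (sym (trans (∑-const (allFin N) w) (cong (_* w) (Listₚ.length-tabulate {n = N} id)))) lt)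
    ... | i , _ , few = i , few

    -- Double counting: each `r` with `e r` in `I` has an occurrence in `I`, and by injectivity an
    -- occurrence serves at most one `r`. The lemma is applied to the edges and to the patches of a
    -- row.
    ∈-ownedBy : ∀ {m} (e : Fin m → Fin cells) → (∀ {r s} → e r ≡ e s → r ≡ s) → ∀ i → (∀ r → owner (e r) ≡ i) →
                ∑ (allFin m) (λ r → 𝟙 (does (e r ∈? I))) ≤ ownedBy i
    ∈-ownedBy {m} e e-inj i e-owner = begin
      ∑ (allFin m) (λ r → 𝟙 (does (e r ∈? I)))                          ≤⟨ ∑-mono (allFin m) member ⟩
      ∑ (allFin m) (λ r → ∑ I λ v → 𝟙 (does (v Finₚ.≟ e r)))            ≡⟨ ∑-swap (allFin m) I _ ⟩
      ∑ I (λ v → ∑ (allFin m) λ r → 𝟙 (does (v Finₚ.≟ e r)))            ≤⟨ ∑-mono I once ⟩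
      ownedBy i                                                         ∎
      where
      open ≤-Reasoning
      member : ∀ r → 𝟙 (does (e r ∈? I)) ≤ ∑ I (λ v → 𝟙 (does (v Finₚ.≟ e r)))
      member r with e r ∈? I
      ... | no  _  = z≤n
      ... | yes r∈ = ≤-trans (≤-reflexive (sym (𝟙-yes (e r Finₚ.≟ e r) refl))) (f≤∑ (λ v → 𝟙 (does (v Finₚ.≟ e r))) r∈)
      once : ∀ v → ∑ (allFin m) (λ r → 𝟙 (does (v Finₚ.≟ e r))) ≤ 𝟙 (does (i Finₚ.≟ owner v))
      once v with i Finₚ.≟ owner v
      ... | yes _ = ∑-at-most-one m _ λ {r} {s} tr ts →
                      e-inj (trans (sym (T-does (v Finₚ.≟ e r) tr)) (T-does (v Finₚ.≟ e s) ts))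
      ... | no i≢ = ≤-trans (∑-mono (allFin m) {g = λ _ → 0} λ r → ≤-reflexive
                      (𝟙-no (v Finₚ.≟ e r) λ { refl → i≢ (sym (e-owner r)) }))
                    (≤-reflexive (trans (∑-const (allFin m) 0) (*-zeroʳ (length (allFin m)))))

    module _ (i : Fin N) (few : ownedBy i < w) where

      planted : Fin cells → Bool
      planted v = does (i Finₚ.≟ owner v) ∧ not (does (v ∈? I))

      planted-I : ∀ {v} → v ∈ₗ I → planted v ≡ false
      planted-I {v} v∈ with v ∈? I
      ... | yes _  = Boolₚ.∧-zeroʳ _
      ... | no  v∉ = contradiction v∈ v∉

      planted-other : ∀ {j} c → j ≢ i → planted (combine j c) ≡ false
      planted-other {j} c j≢i with i Finₚ.≟ owner (combine j c)
      ... | yes eq = contradiction (sym (trans eq (owner-combine j c))) j≢i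
      ... | no  _  = refl

      planted-own : ∀ c → planted (combine i c) ≡ not (does (combine i c ∈? I))
      planted-own c with i Finₚ.≟ owner (combine i c)
      ... | yes _  = refl
      ... | no neq = contradiction (sym (owner-combine i c)) neq

      -- Incoming edges and the patches of other vertices lie in other rows, hence are unset. Since
      -- `I` meets row `i` in fewer than `w` cells, one of its `w` patch bits remains set and at
      -- most `w` of its edges are absent.
      planted-source : T (eval (isSource i) planted)
      planted-source = allFalse-complete planted (incoming i) _ no-in
        (someTrue-complete planted _ (Memₚ.∈-map⁺ (patch i) (Memₚ.∈-allFin (proj₁ free))) (proj₂ free)
          (outgoing-complete planted i (others i) w holes few-holes))
        where
        no-in : ∀ {v} → v ∈ₗ incoming i → planted v ≡ false
        no-in v∈ with Memₚ.∈-map⁻ (λ j → edge j i) v∈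
        ... | j , j∈ , refl = planted-other (i Fin.↑ˡ w) (others-≢ j∈)

        holes : ∀ {j} → j ∈ₗ others i → ∀ {v} → v ∈ₗ patches j → planted v ≡ false
        holes {j} j∈ v∈ with Memₚ.∈-map⁻ (patch j) v∈
        ... | r , _ , refl = planted-other (N Fin.↑ʳ r) (others-≢ j∈)

        free : ∃ λ r → planted (patch i r) ≡ true
        free with ∑-<⇒∃ (allFin w) {λ r → 𝟙 (does (patch i r ∈? I))} {λ _ → 1} (≤-<-trans
          (∈-ownedBy (patch i) (λ {r} {s} eq → Finₚ.↑ʳ-injective N r s (Finₚ.combine-injectiveʳ i (N Fin.↑ʳ r) i (N Fin.↑ʳ s) eq)) i
            (λ r → owner-combine i (N Fin.↑ʳ r)))
          (subst (ownedBy i <_) (sym (trans (length-as-∑ (allFin w)) (Listₚ.length-tabulate {n = w} id))) few))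
        ... | r , _ , lt = r , trans (planted-own (N Fin.↑ʳ r)) (𝟙<1⇒not (does (patch i r ∈? I)) lt)
          where
          𝟙<1⇒not : ∀ b → 𝟙 b < 1 → not b ≡ true
          𝟙<1⇒not false _ = refl
          𝟙<1⇒not true  (s≤s ())

        few-holes : ∑ (others i) (λ j → 𝟙 (not (planted (edge i j)))) ≤ w
        few-holes = begin
          ∑ (others i) (λ j → 𝟙 (not (planted (edge i j))))
            ≤⟨ ∑-filter-≤ (λ j → ¬? (j Finₚ.≟ i)) (allFin N) _ ⟩
          ∑ (allFin N) (λ j → 𝟙 (not (planted (edge i j))))
            ≡⟨ ∑-cong (allFin N) (λ j → cong 𝟙 (trans (cong not (planted-own (j Fin.↑ˡ w))) (Boolₚ.not-involutive _))) ⟩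
          ∑ (allFin N) (λ j → 𝟙 (does (edge i j ∈? I)))
            ≤⟨ ∈-ownedBy (edge i) (λ {r} {s} eq → Finₚ.↑ˡ-injective w r s (Finₚ.combine-injectiveʳ i (r Fin.↑ˡ w) i (s Fin.↑ˡ w) eq)) i
                 (λ r → owner-combine i (r Fin.↑ˡ w)) ⟩
          ownedBy i
            ≤⟨ <⇒≤ few ⟩
          w ∎
          where open ≤-Reasoning

  -- Hardness and the unambiguous partition for the lifted query function

  module Communication (q : ℕ) where

    open Index cells q
    open Lifting cells q hasSource
    open TreeRectangles cells q

    -- The certificate is the accepting run of `isSource i` on the planted input.
    hard : HardAtZero certificateSize (N * w)
    hard I small with exposed I small
    ... | i , few = planted I i few , planted-I I i few , path (isSource i) (planted I i few) ,
          ≤-trans (length-path (isSource i) _) (depth-isSource i) ,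
          λ z′ agree → isSource⇒hasSource z′ i
            (subst T (sym (eval-path (isSource i) (planted I i few) z′ agree)) (planted-source I i few))

    partition : List (Rectangle X Y)
    partition = concatMap (rectangles ∘ isSource) (allFin N)

    -- The rectangles containing an input are counted by its accepting vertices. There is at most
    -- one such vertex, so the count is the function value itself.
    partition-multiplicity : ∀ x y → ∑ partition (hits x y) ≡ 𝟙 (lifted (x , y))
    partition-multiplicity x y = trans (∑-concatMap _ (allFin N) (hits x y))
      (trans (∑-cong (allFin N) λ i → rectangles-multiplicity (isSource i) x y) (sources≡ (answers x y)))

    partition-disjoint : PairwiseDisjoint (List.lookup partition)
    partition-disjoint = lookup-disjoint partition λ x y →
      ≤-trans (≤-reflexive (partition-multiplicity x y)) (𝟙≤1 _)

    partition-covers : Covers (List.lookup partition) (lifted ⁻¹ true)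
    partition-covers = lookup-covers lifted partition partition-multiplicity

    length-partition : .{{_ : NonZero q}} → length partition ≤ N * (2 * q) ^ certificateSize
    length-partition = begin
      length partition                                                ≡⟨ length-as-∑ partition ⟨
      ∑ partition (λ _ → 1)                                           ≡⟨ ∑-concatMap _ (allFin N) _ ⟩
      ∑ (allFin N) (λ i → ∑ (rectangles (isSource i)) (λ _ → 1))      ≤⟨ ∑-mono (allFin N) (λ i →
        ≤-trans (≤-reflexive (length-as-∑ (rectangles (isSource i)))) (length-rectangles (isSource i) _ (depth-isSource i))) ⟩
      ∑ (allFin N) (λ _ → (2 * q) ^ certificateSize)                  ≡⟨ trans (∑-const (allFin N) _) (cong (_* (2 * q) ^ certificateSize) (Listₚ.length-tabulate {n = N} id)) ⟩
      N * (2 * q) ^ certificateSize                                   ∎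
      where open ≤-Reasoning

-- Comparing powers of rational logarithms

ι : ℕ → ℚ
ι n = ℚ.mkℚ (ℤ.+ n) 0 (Coprimality.sym (Coprimality.1-coprimeTo n))

ι-* : ∀ m n → ι m ℚ.* ι n ≡ ι (m * n)
ι-* m n = ℚₚ.toℚᵘ-injective (ℚᵘₚ.≃-trans (ℚₚ.toℚᵘ-homo-* (ι m) (ι n))
  (ℚᵘ.*≡* (cong (ℤ._* ℤ.+ 1) (sym (ℤₚ.pos-* m n)))))

ι-^ : ∀ m n → ι m Power.^ n ≡ ι (m ^ n)
ι-^ m zero    = refl
ι-^ m (suc n) = trans (cong (ι m ℚ.*_) (ι-^ m n)) (ι-* m (m ^ n))

ι-mono-≤ : ∀ {m n} → m ≤ n → ι m ℚ.≤ ι n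
ι-mono-≤ m≤n = ℚ.*≤* (ℤₚ.*-monoʳ-≤-nonNeg (ℤ.+ 1) (ℤ.+≤+ m≤n))

^-nonNeg : ∀ x → ℚ.NonNegative x → ∀ n → ℚ.NonNegative (x Power.^ n)
^-nonNeg x x≥0 zero    = _
^-nonNeg x x≥0 (suc n) = ℚₚ.nonNeg*nonNeg⇒nonNeg x {{x≥0}} (x Power.^ n) {{^-nonNeg x x≥0 n}}

^ℚ-mono-≤ : ∀ {x y} → ℚ.NonNegative x → ℚ.NonNegative y → x ℚ.≤ y → ∀ n → x Power.^ n ℚ.≤ y Power.^ n
^ℚ-mono-≤ x≥0 y≥0 x≤y zero    = ℚₚ.≤-refl
^ℚ-mono-≤ {x} {y} x≥0 y≥0 x≤y (suc n) = ℚₚ.≤-trans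
  (ℚₚ.*-monoˡ-≤-nonNeg x {{x≥0}} (^ℚ-mono-≤ x≥0 y≥0 x≤y n))
  (ℚₚ.*-monoʳ-≤-nonNeg (y Power.^ n) {{^-nonNeg y y≥0 n}} x≤y)

^ℚ-inverse : ∀ x y → x ℚ.* y ≡ ℚ.1ℚ → ∀ n → (x Power.^ n) ℚ.* (y Power.^ n) ≡ ℚ.1ℚ
^ℚ-inverse x y eq zero    = refl
^ℚ-inverse x y eq (suc n) = begin
  (x ℚ.* x Power.^ n) ℚ.* (y ℚ.* y Power.^ n)      ≡⟨ interchange x (x Power.^ n) y (y Power.^ n) ⟩
  (x ℚ.* y) ℚ.* (x Power.^ n ℚ.* y Power.^ n)      ≡⟨ cong₂ ℚ._*_ eq (^ℚ-inverse x y eq n) ⟩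
  ℚ.1ℚ ℚ.* ℚ.1ℚ                                    ≡⟨⟩
  ℚ.1ℚ                                             ∎
  where
  open ≡-Reasoning
  open CommutativeSemigroupₚ (CommutativeMonoid.commutativeSemigroup ℚₚ.*-1-commutativeMonoid) using (interchange)

2^-cancel-≤ : ∀ {m n} → 2 ^ m ≤ 2 ^ n → m ≤ n
2^-cancel-≤ {m} {n} le = ≮⇒≥ λ n<m → <⇒≱ (^-monoʳ-< 2 ≤-refl n<m) le

-- With `r = p / suc d`, the chain `2 ^ p ≤ u ^ suc d ≤ 2 ^ (U * suc d)` compares exponents.
≤log₂⇒≤ι : ∀ {r u U} → ℚ.NonNegative r → r ≤log₂ u → u ≤ 2 ^ U → r ℚ.≤ ι U
≤log₂⇒≤ι {ℚ.mkℚ (ℤ.+ p) d _} {u} {U} _ le u≤ = ℚ.*≤* (subst₂ ℤ._≤_ (sym (ℤₚ.*-identityʳ (ℤ.+ p))) (ℤₚ.pos-* U (suc d))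
  (ℤ.+≤+ (2^-cancel-≤ (≤-trans le (≤-trans (^-monoˡ-≤ (suc d) u≤) (≤-reflexive (^-*-assoc 2 U (suc d))))))))

>log₂⇒≥ι : ∀ {s v V} → ℚ.NonNegative s → s >log₂ v → 2 ^ V ≤ v → ι V ℚ.≤ s
>log₂⇒≥ι {ℚ.mkℚ (ℤ.+ p) d _} {v} {V} _ gt ≤v = ℚ.*≤* (subst₂ ℤ._≤_ (ℤₚ.pos-* V (suc d)) (sym (ℤₚ.*-identityʳ (ℤ.+ p)))
  (ℤ.+≤+ (2^-cancel-≤ (≤-trans (≤-reflexive (sym (^-*-assoc 2 V (suc d)))) (≤-trans (^-monoˡ-≤ (suc d) ≤v) (<⇒≤ gt))))))

-- C w⁴ ≥ log₂ u and w⁵ ≤ log₂ v: the exponent a/b ≤ 5/4 absorbs w, and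
-- a ≤ 2b lets c = 1/C² absorb the constant.
logPowerBound : ∀ C w {a b u v c} .{{_ : NonZero C}} → 4 * suc a ≤ 5 * b → suc a ≤ 2 * b →
                ℚ.NonNegative c → c ℚ.* ι (C * C) ≡ ℚ.1ℚ →
                u ≤ 2 ^ (C * w ^ 4) → 2 ^ (w ^ 5) ≤ v → LogPowerBound c (suc a) b u v
logPowerBound C w {a′} {b} {u} {v} {c} 4a≤5b a≤2b c≥0 c-inv u≤ ≤v r s r≥0 s≥0 r≤ s> = begin
  (c Power.^ b) ℚ.* (r Power.^ a)
    ≤⟨ ℚₚ.*-monoˡ-≤-nonNeg (c Power.^ b) {{^-nonNeg c c≥0 b}} (^ℚ-mono-≤ r≥0 _ (≤log₂⇒≤ι {r} r≥0 r≤ u≤) a) ⟩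
  (c Power.^ b) ℚ.* (ι (C * w ^ 4) Power.^ a)
    ≡⟨ cong ((c Power.^ b) ℚ.*_) (ι-^ (C * w ^ 4) a) ⟩
  (c Power.^ b) ℚ.* ι ((C * w ^ 4) ^ a)
    ≤⟨ ℚₚ.*-monoˡ-≤-nonNeg (c Power.^ b) {{^-nonNeg c c≥0 b}} (ι-mono-≤ powers) ⟩
  (c Power.^ b) ℚ.* ι ((C * C) ^ b * (w ^ 5) ^ b)
    ≡⟨ cong ((c Power.^ b) ℚ.*_) (trans (sym (ι-* ((C * C) ^ b) ((w ^ 5) ^ b))) (cong₂ ℚ._*_ (sym (ι-^ (C * C) b)) (sym (ι-^ (w ^ 5) b)))) ⟩
  (c Power.^ b) ℚ.* (ι (C * C) Power.^ b ℚ.* ι (w ^ 5) Power.^ b)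
    ≡⟨ ℚₚ.*-assoc (c Power.^ b) (ι (C * C) Power.^ b) (ι (w ^ 5) Power.^ b) ⟨
  (c Power.^ b ℚ.* ι (C * C) Power.^ b) ℚ.* ι (w ^ 5) Power.^ b
    ≡⟨ trans (cong (ℚ._* ι (w ^ 5) Power.^ b) (^ℚ-inverse c (ι (C * C)) c-inv b)) (ℚₚ.*-identityˡ _) ⟩
  ι (w ^ 5) Power.^ b
    ≤⟨ ^ℚ-mono-≤ _ s≥0 (>log₂⇒≥ι {s} s≥0 s> ≤v) b ⟩
  s Power.^ b ∎
  where
  open ℚₚ.≤-Reasoning
  a : ℕ
  a = suc a′

  w-powers : ∀ w → w ^ (4 * a) ≤ w ^ (5 * b)
  -- The exponent `4 * a` is positive because `a` is a successor, so the left side is `0`.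
  w-powers zero    = z≤n
  w-powers (suc w) = ^-monoʳ-≤ (suc w) 4a≤5b

  powers : (C * w ^ 4) ^ a ≤ (C * C) ^ b * (w ^ 5) ^ b
  powers = ≤-trans (≤-reflexive (^-distribʳ-* C (w ^ 4) a)) (*-mono-≤
    (≤-trans (^-monoʳ-≤ C a≤2b) (≤-reflexive (trans (sym (^-*-assoc C 2 b)) (cong (λ x → (C * x) ^ b) (*-identityʳ C)))))
    (subst₂ _≤_ (sym (^-*-assoc w 4 a)) (sym (^-*-assoc w 5 b)) (w-powers w)))

-- Transport of covers

module _ {X Y X′ Y′ : Set} (g : X′ → X) (h : Y′ → Y) where

  open Rectangle

  pullback : Rectangle X Y → Rectangle X′ Y′
  pullback R = record { rows = rows R ∘ g ; columns = columns R ∘ h }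

  pullback-covers : ∀ (F : TwoParty X Y) (G : TwoParty X′ Y′) → (∀ x y → F (g x , h y) ≡ G (x , y)) →
                    ∀ {c b} {R : Fin c → Rectangle X Y} → Covers R (F ⁻¹ b) → Covers (pullback ∘ R) (G ⁻¹ b)
  pullback-covers F G eq (inside , outside) =
    (λ { {x , y} p → trans (inside p) (eq x y) }) , (λ { {x , y} b≡ → outside (trans b≡ (sym (eq x y))) })

  pullback-disjoint : ∀ {c} {R : Fin c → Rectangle X Y} → PairwiseDisjoint R → PairwiseDisjoint (pullback ∘ R)
  pullback-disjoint disjoint i≢j {x , y} = disjoint i≢j {g x , h y}

-- A cover of the ones by u rectangles partitions the rows into 2 ^ u classes,
-- according to which rectangles they meet.
complement-cover : ∀ {X Y : Set} (F : TwoParty X Y) {u} (R : Fin u → Rectangle X Y) → Covers R (F ⁻¹ true) →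
                   ∃ λ (S : Fin (2 ^ u) → Rectangle X Y) → Covers S (F ⁻¹ false)
complement-cover {X} {Y} F {u} R (inside , outside) = S , S-inside , S-outside
  where
  open Rectangle

  toBit : Bool → Fin 2
  toBit false = Fin.zero
  toBit true  = Fin.suc Fin.zero

  Row : Fin (2 ^ u) → X → Fin u → Set
  Row e x i = toBit (rows (R i) x) ≡ Fin.finToFun e i

  -- A column joins class `e` when it lies in no rectangle that the rows of the class meet, so that
  -- `F` vanishes on all these rows in this column.
  Column : Fin (2 ^ u) → Y → Fin u → Set
  Column e y i = T (columns (R i) y) → Fin.finToFun e i ≡ Fin.zero

  row? : ∀ e x → Dec (∀ i → Row e x i)
  row? e x = Finₚ.all? λ i → _ Finₚ.≟ _

  column? : ∀ e y → Dec (∀ i → Column e y i)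
  column? e y = Finₚ.all? λ i → Boolₚ.T? _ →-dec (_ Finₚ.≟ _)

  S : Fin (2 ^ u) → Rectangle X Y
  S e = record { rows = λ x → does (row? e x) ; columns = λ y → does (column? e y) }

  S-inside : ∀ {p} → _ → false ≡ F p
  S-inside {x , y} (e , x∈ , y∈) with F (x , y) in eq
  ... | false = refl
  ... | true  with outside {x , y} (sym eq)
  ...   | i , xi , yi with trans (sym (cong toBit (Boolₚ.T-≡ .Equivalence.to xi)))
                                (trans (T-does (row? e x) x∈ i) (T-does (column? e y) y∈ i yi))
  ...     | ()

  does-T : ∀ {P : Set} (P? : Dec P) → P → T (does P?)
  does-T (yes _) p = tt
  does-T (no ¬p) p = contradiction p ¬p

  S-outside : ∀ {p} → false ≡ F p → _
  S-outside {x , y} F≡ = e , does-T (row? e x) row , does-T (column? e y) column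
    where
    e : Fin (2 ^ u)
    e = Fin.funToFin (λ i → toBit (rows (R i) x))

    row : ∀ i → Row e x i
    row i = sym (Finₚ.finToFun-funToFin (λ i → toBit (rows (R i) x)) i)

    column : ∀ i → Column e y i
    column i yi with rows (R i) x in eq | sym (row i)
    ... | false | bit = bit
    ... | true  | _   = contradiction (trans F≡ (sym (inside (i , subst T (sym eq) tt , yi)))) λ ()

-- Encoding the inputs as bit strings

resize : ∀ {k} m → Vec Bool k → Vec Bool m
resize zero    bs       = []
resize (suc m) []       = false ∷ resize m []
resize (suc m) (b ∷ bs) = b ∷ resize m bs

resize-resize : ∀ {k m} → k ≤ m → (bs : Vec Bool k) → resize k (resize m bs) ≡ bs
resize-resize z≤n       []       = refl
resize-resize (s≤s k≤m) (b ∷ bs) = cong (b ∷_) (resize-resize k≤m bs)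

module Encoding (n q : ℕ) .{{_ : NonZero q}} where

  open Index n q

  firstTrue : (Fin q → Bool) → Fin q
  firstTrue p with Finₚ.any? (λ a → Boolₚ.T? (p a))
  ... | yes (a , _) = a
  ... | no  _       = Fin.fromℕ< (>-nonZero⁻¹ q)

  firstTrue-≟ : ∀ p b → (∀ a → p a ≡ does (a Finₚ.≟ b)) → firstTrue p ≡ b
  firstTrue-≟ p b eq with Finₚ.any? (λ a → Boolₚ.T? (p a))
  ... | yes (a , t) = T-does (a Finₚ.≟ b) (subst T (eq a) t)
  ... | no  none    = contradiction (b , subst T (sym (trans (eq b) (dec-true (b Finₚ.≟ b) refl))) tt) none

  -- One-hot addresses make Alice's input exactly as long as Bob's tables. Decoding stays total
  -- because `firstTrue` has a default address for blocks without a set bit.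
  unaryX : X → Vec Bool (n * q)
  unaryX x = Vec.tabulate λ e → let v , a = Fin.remQuot q e in does (a Finₚ.≟ lookup x v)

  decodeX : ∀ {m} → Vec Bool m → X
  decodeX bs = Vec.tabulate λ v → firstTrue λ a → lookup (resize (n * q) bs) (combine v a)

  encodeX : ∀ m → X → Vec Bool m
  encodeX m x = resize m (unaryX x)

  decode-encodeX : ∀ {m} → n * q ≤ m → ∀ x → decodeX (encodeX m x) ≡ x
  decode-encodeX {m} fits x = trans (Vecₚ.tabulate-cong λ v → firstTrue-≟ _ (lookup x v) λ a → begin
      lookup (resize (n * q) (resize m (unaryX x))) (combine v a)
        ≡⟨ cong (λ bs → lookup bs (combine v a)) (resize-resize fits (unaryX x)) ⟩
      lookup (unaryX x) (combine v a)
        ≡⟨ Vecₚ.lookup∘tabulate _ (combine v a) ⟩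
      does (proj₂ (Fin.remQuot {n} q (combine v a)) Finₚ.≟ lookup x (proj₁ (Fin.remQuot {n} q (combine v a))))
        ≡⟨ cong (λ p → does (proj₂ p Finₚ.≟ lookup x (proj₁ p))) (Finₚ.remQuot-combine v a) ⟩
      does (a Finₚ.≟ lookup x v) ∎)
    (Vecₚ.tabulate∘lookup x)
    where open ≡-Reasoning

-- The default `0` is why `largest-fits` assumes `g 0 ≤ m`.
largest : (ℕ → ℕ) → ℕ → ℕ → ℕ
largest g m zero    = 0
largest g m (suc b) with g (suc b) ≤? m
... | yes _ = suc b
... | no  _ = largest g m b

largest-fits : ∀ (g : ℕ → ℕ) m b → g 0 ≤ m → g (largest g m b) ≤ m
largest-fits g m zero    g0≤m = g0≤m
largest-fits g m (suc b) g0≤m with g (suc b) ≤? m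
... | yes le = le
... | no  _  = largest-fits g m b g0≤m

largest-maximal : ∀ (g : ℕ → ℕ) m b {w} → w ≤ b → g w ≤ m → w ≤ largest g m b
largest-maximal g m zero    w≤b gw≤m = w≤b
largest-maximal g m (suc b) w≤b gw≤m with g (suc b) ≤? m
... | yes _ = w≤b
... | no ≰m with m≤n⇒m<n∨m≡n w≤b
...   | inj₁ (s≤s w≤b′) = largest-maximal g m b w≤b′ gw≤m
...   | inj₂ refl        = contradiction gw≤m ≰m

n<2^n : ∀ n → n < 2 ^ n
n<2^n zero    = z<s
n<2^n (suc n) = begin-strict
  1 + n             <⟨ +-mono-≤-< (m^n>0 2 n) (n<2^n n) ⟩
  2 ^ n + 2 ^ n     ≡⟨ cong (2 ^ n +_) (+-identityʳ _) ⟨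
  2 ^ suc n         ∎
  where open ≤-Reasoning

m≤m*m : ∀ m → m ≤ m * m
m≤m*m zero      = z≤n
m≤m*m m@(suc _) = m≤m*n m m

-- Choice of parameters

module Parameters (w : ℕ) where

  -- `τ` is the square root of `q`. The `20` in `s` beats the `19` that arises in `τ-large`, and `D`
  -- makes `D-large` an equality.
  N s t τ q K D : ℕ
  N = w * w
  s = 20 * (w * w)
  t = s + s
  τ = 2 ^ s
  q = 2 ^ t
  K = N * w

  open Source N w using (cells; certificateSize)

  D = cells + t * K

  certificateSize≤ : certificateSize ≤ 4 * (w * w)
  certificateSize≤ = begin
    N + (w + (N + N))       ≤⟨ +-monoʳ-≤ N (+-monoˡ-≤ (N + N) (m≤m*m w)) ⟩
    N + (N + (N + N))       ≡⟨ solve 1 (λ n → n :+ (n :+ (n :+ n)) := con 4 :* n) refl N ⟩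
    4 * (w * w)             ∎
    where open ≤-Reasoning

  D-large : 2 ^ cells * q ^ K ≤ 2 ^ D
  D-large = ≤-reflexive (trans (cong (2 ^ cells *_) (^-*-assoc 2 t K)) (sym (^-distribˡ-+-* 2 cells (t * K))))

  partition-size : N * (2 * q) ^ certificateSize ≤ 2 ^ (165 * w ^ 4)
  partition-size = begin
    N * (2 * q) ^ certificateSize              ≤⟨ *-monoˡ-≤ _ (<⇒≤ (n<2^n N)) ⟩
    2 ^ N * (2 ^ suc t) ^ certificateSize      ≡⟨ cong (2 ^ N *_) (^-*-assoc 2 (suc t) certificateSize) ⟩
    2 ^ N * 2 ^ (suc t * certificateSize)      ≡⟨ ^-distribˡ-+-* 2 N _ ⟨
    2 ^ (N + suc t * certificateSize)          ≤⟨ ^-monoʳ-≤ 2 exponent ⟩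
    2 ^ (165 * w ^ 4)                          ∎
    where
    open ≤-Reasoning
    -- `165 = 5 + 160`: the quadratic term is `40 * 4`, and the linear `5 * N` is rounded up to
    -- `5 * (N * N)`.
    exponent : N + suc t * certificateSize ≤ 165 * w ^ 4
    exponent = begin
      N + suc t * certificateSize              ≤⟨ +-monoʳ-≤ N (*-monoʳ-≤ (suc t) certificateSize≤) ⟩
      N + suc t * (4 * N)                      ≡⟨ solve 1 (λ n → n :+ (con 1 :+ (con 20 :* n :+ con 20 :* n)) :* (con 4 :* n) :=
                                                    con 5 :* n :+ con 160 :* (n :* n)) refl N ⟩
      5 * N + 160 * (N * N)                    ≤⟨ +-monoˡ-≤ (160 * (N * N)) (*-monoʳ-≤ 5 (m≤m*m N)) ⟩
      5 * (N * N) + 160 * (N * N)              ≡⟨ *-distribʳ-+ (N * N) 5 160 ⟨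
      165 * (N * N)                            ≡⟨ cong (165 *_) (solve 1 (λ w → (w :* w) :* (w :* w) := w :* (w :* (w :* (w :* con 1)))) refl w) ⟩
      165 * w ^ 4                              ∎

  -- Since `q = τ * τ`, one factor `τ ^ K = 2 ^ (20 * w ^ 5)` survives the cancellation.
  cover-size : ∀ {c} → q ^ K ≤ c * τ ^ K → 2 ^ (w ^ 5) ≤ c
  cover-size {c} le = begin
    2 ^ (w ^ 5)       ≤⟨ ^-monoʳ-≤ 2 w^5≤s*K ⟩
    2 ^ (s * K)       ≡⟨ ^-*-assoc 2 s K ⟨
    τ ^ K             ≤⟨ *-cancelʳ-≤ (τ ^ K) c (τ ^ K) {{m^n≢0 τ K {{m^n≢0 2 s}}}} (subst (_≤ c * τ ^ K) split le) ⟩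
    c                 ∎
    where
    open ≤-Reasoning
    split : q ^ K ≡ τ ^ K * τ ^ K
    split = trans (cong (_^ K) (^-distribˡ-+-* 2 s s)) (^-distribʳ-* τ τ K)

    w^5≤s*K : w ^ 5 ≤ s * K
    w^5≤s*K = begin
      w ^ 5           ≤⟨ m≤n*m (w ^ 5) 20 ⟩
      20 * w ^ 5      ≡⟨ solve 1 (λ w → con 20 :* (w :* (w :* (w :* (w :* (w :* con 1))))) :=
                           con 20 :* (w :* w) :* (w :* w :* w)) refl w ⟩
      s * K           ∎

-- The exponential part is at most `2 ^ (4 * (w * w))`. The polynomial rest, at most `168 * w ^ 7`,
-- is bounded by `2 ^ (8 + w * 7)` through `w < 2 ^ w`.
τ-large : ∀ w → let open Parameters w; open Source N w in 2 ^ certificateSize * D * certificateSize < τ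
τ-large zero      = z<s
τ-large w@(suc _) = begin-strict
  2 ^ certificateSize * D * certificateSize      ≡⟨ *-assoc (2 ^ certificateSize) D certificateSize ⟩
  2 ^ certificateSize * (D * certificateSize)    ≤⟨ *-mono-≤ (^-monoʳ-≤ 2 certificateSize≤) polynomial ⟩
  2 ^ (4 * N) * 2 ^ (8 + w * 7)                  ≡⟨ ^-distribˡ-+-* 2 (4 * N) (8 + w * 7) ⟨
  2 ^ (4 * N + (8 + w * 7))                      <⟨ ^-monoʳ-< 2 ≤-refl exponent ⟩
  τ                                              ∎
  where
  open Parameters w
  open Source N w using (cells; certificateSize)
  open ≤-Reasoning

  D≤ : D ≤ 42 * w ^ 5
  D≤ = begin
    N * (N + w) + t * K
      ≤⟨ +-monoˡ-≤ (t * K) (*-monoʳ-≤ N (+-monoʳ-≤ N (m≤m*m w))) ⟩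
    N * (N + N) + t * K
      ≤⟨ +-monoˡ-≤ (t * K) (m≤m*n (N * (N + N)) w) ⟩
    N * (N + N) * w + t * K
      ≡⟨ solve 1 (λ w → w :* w :* (w :* w :+ w :* w) :* w :+ (con 20 :* (w :* w) :+ con 20 :* (w :* w)) :* (w :* w :* w) :=
           con 42 :* (w :* (w :* (w :* (w :* (w :* con 1)))))) refl w ⟩
    42 * w ^ 5 ∎

  polynomial : D * certificateSize ≤ 2 ^ (8 + w * 7)
  polynomial = begin
    D * certificateSize        ≤⟨ *-mono-≤ D≤ certificateSize≤ ⟩
    42 * w ^ 5 * (4 * N)       ≡⟨ solve 1 (λ w → con 42 :* (w :* (w :* (w :* (w :* (w :* con 1))))) :* (con 4 :* (w :* w)) :=
                                    con 168 :* (w :* (w :* (w :* (w :* (w :* (w :* (w :* con 1)))))))) refl w ⟩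
    168 * w ^ 7                ≤⟨ *-mono-≤ (≤ᵇ⇒≤ 168 256 tt) (^-monoˡ-≤ 7 (<⇒≤ (n<2^n w))) ⟩
    2 ^ 8 * (2 ^ w) ^ 7        ≡⟨ cong (2 ^ 8 *_) (^-*-assoc 2 w 7) ⟩
    2 ^ 8 * 2 ^ (w * 7)        ≡⟨ ^-distribˡ-+-* 2 8 (w * 7) ⟨
    2 ^ (8 + w * 7)            ∎

  exponent : 4 * N + (8 + w * 7) < s
  exponent = begin-strict
    -- As `w` is positive, `8` and `w` are bounded by `8 * w ^ 2` and `w * w`, and `4 + 8 + 7 = 19`.
    4 * N + (8 + w * 7)              ≤⟨ +-monoʳ-≤ (4 * N) (+-mono-≤ (*-monoʳ-≤ 8 (m^n>0 w 2)) (*-monoˡ-≤ 7 (m≤m*m w))) ⟩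
    4 * N + (8 * w ^ 2 + N * 7)      ≡⟨ solve 1 (λ w → con 4 :* (w :* w) :+ (con 8 :* (w :* (w :* con 1)) :+ w :* w :* con 7) :=
                                          con 19 :* (w :* w)) refl w ⟩
    19 * N                           <⟨ *-monoˡ-< N (≤ᵇ⇒≤ 20 20 tt) ⟩
    s                                ∎

-- The family of functions and its two bounds

module Member (w m : ℕ) where

  open Parameters w
  open Source N w
  open Communication q
  open Index cells q using (X; Y)
  open Lifting cells q hasSource using (lifted; module LowerBound)

  instance
    q≢0 : NonZero q
    q≢0 = m^n≢0 2 t

  open Encoding cells q

  inputBits : ℕ
  inputBits = cells * q

  -- The partition pulls back along the decodings for the upper bound. When the input fits, the
  -- encodings are sections of them, and covers pull back along these for the lower bound.
  function : BooleanFunction m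
  function (x , y) = lifted (decodeX x , resize inputBits y)

  UP≤ : ∀ {u} → IsUPNumber function u → u ≤ 2 ^ (165 * w ^ 4)
  UP≤ (_ , minimal) = ≤-trans
    (minimal (pullback decodeX (resize inputBits) ∘ List.lookup partition , pullback-disjoint decodeX (resize inputBits) {R = List.lookup partition} partition-disjoint ,
      pullback-covers decodeX (resize inputBits) lifted function (λ _ _ → refl) {R = List.lookup partition} partition-covers))
    (≤-trans length-partition partition-size)

  cover≥ : inputBits ≤ m → ∀ {c} (R : Fin c → Rectangle _ _) → Covers R (function ⁻¹ false) → 2 ^ (w ^ 5) ≤ c
  cover≥ fits R covers = cover-size (cover-bound hasSource-zero _ (pullback-covers (encodeX m) (resize m) function lifted
      (λ x y → cong₂ (λ x y → lifted (x , y)) (decode-encodeX fits x) (resize-resize fits y)) {R = R} covers))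
    where open LowerBound certificateSize K D τ hard D-large (τ-large w)

  -- Only divergence is at stake, so the exponential loss in `complement-cover` is affordable: the
  -- zeros get a cover by `2 ^ u` rectangles, whence `2 ^ (w ^ 5) ≤ 2 ^ u`.
  UP≥ : inputBits ≤ m → ∀ {u} → IsUPNumber function u → w ^ 5 ≤ u
  UP≥ fits ((R , _ , covers) , _) = let S , S-covers = complement-cover function R covers
                                    in 2^-cancel-≤ (cover≥ fits S S-covers)

-- Taking the largest parameter whose encoding fits defines a member at every input length, so the
-- index set is all of ℕ.
width : ℕ → ℕ
width m = largest (λ w → Member.inputBits w m) m m

width-fits : ∀ m → Member.inputBits (width m) m ≤ m
width-fits m = largest-fits (λ w → Member.inputBits w m) m m z≤n

theorem6 : ∃ λ (I : Pred ℕ 0ℓ) →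
    Σ ((n : ℕ) → BooleanFunction n) λ f →
    Infinite I ×
    UPTendsToInfinity I f ×
    (∃ λ (c : ℚ) → Positive c ×
    (∀ n → n ∈ I → ∀ u v → IsUPNumber (f n) u → IsCoNPNumber (f n) v →
    LogPowerBound c 61 50 u v))
theorem6 =
  (λ _ → ⊤) , (λ n → Member.function (width n) n) , (λ m → m , ≤-refl , tt) ,
  -- The first summand puts `2 ^ k` into the search range of `width n`, the second makes its
  -- encoding fit.
  (λ k → 2 ^ k + Member.inputBits (2 ^ k) 0 , λ n _ large u up → unbounded k n large up) ,
  -- `165` is the constant of `partition-size`, squared as `logPowerBound` asks.
  (ℤ.+ 1 ℚ./ (165 * 165)) , _ ,
  λ n _ u v up ((R , covers) , _) → logPowerBound 165 (width n) {60} {50} {u} {v} {ℤ.+ 1 ℚ./ (165 * 165)}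
    -- The exponent `1.22` is `61 / 50`; the two checks are `4 * 61 ≤ 5 * 50` and `61 ≤ 2 * 50`.
    (≤ᵇ⇒≤ 244 250 tt) (≤ᵇ⇒≤ 61 100 tt) _ refl
    (Member.UP≤ (width n) n up) (Member.cover≥ (width n) n (width-fits n) R covers)
  where
  unbounded : ∀ k n → 2 ^ k + Member.inputBits (2 ^ k) 0 ≤ n → ∀ {u} →
              IsUPNumber (Member.function (width n) n) u → 2 ^ k ≤ u
  unbounded k n large {u} up = begin
    2 ^ k          ≤⟨ largest-maximal _ n n (≤-trans (m≤m+n (2 ^ k) _) large) (≤-trans (m≤n+m _ (2 ^ k)) large) ⟩
    width n        ≤⟨ m≤m^5 (width n) ⟩
    width n ^ 5    ≤⟨ Member.UP≥ (width n) n (width-fits n) up ⟩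
    u              ∎
    where
    open ≤-Reasoning
    m≤m^5 : ∀ m → m ≤ m ^ 5
    m≤m^5 zero      = z≤n
    m≤m^5 m@(suc _) = m≤m*n m (m ^ 4) {{m^n≢0 m 4}}
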